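{- Let $n$ and $r$ be positive integers, let $j,k$ be integers and let $S,T\subseteq[n]$. Let $\mathrm{NCN}^{S,T}_{j,k}(n,r)$ denote the number of $r$-colored partitions $\Lambda$ of $[n]$ with $\mathrm{cr}(\Lambda)<j$, $\mathrm{ne}(\Lambda)<k$, $\min(\Lambda)=S$ and $\max(\Lambda)=T$. Then $\mathrm{NCN}^{S,T}_{j,k}(n,r)=\mathrm{NCN}^{S,T}_{k,j}(n,r)$.
   Context: $[n]=\{1,\dots,n\}$. A partition $P$ of $[n]$ is a set of disjoint nonempty subsets (blocks) with union $[n]$. $\mathrm{Arc}(P)$ is the set of pairs $(i,j)$ such that $i,j$ lie in the same block and $j$ is the least element of that block greater than $i$. $\min(P)$ and $\max(P)$ are the sets of minimal and maximal elements of the blocks of $P$. A sequence of arcs $(i_t,j_t)_{t\in[k]}$ of $P$ is a $k$-crossing if $i_1<\dots<i_k<j_1<\dots<j_k$ and a $k$-nesting if $i_1<\dots<i_k<j_k<\dots<j_1$. An $r$-colored partition of $[n]$ is a pair $\Lambda=(P,\varphi)$ with $P$ a partition of $[n]$ and $\varphi:\mathrm{Arc}(P)\to[r]$; $\Lambda$ has a $k$-crossing (resp. $k$-nesting) if $P$ has a $k$-crossing (resp. $k$-nesting) all of whose arcs have the same color under $\varphi$. $\mathrm{cr}(\Lambda)$ and $\mathrm{ne}(\Lambda)$ are the largest $k$ such that $\Lambda$ has a $k$-crossing, resp. $k$-nesting. $\min(\Lambda):=\min(P)$, $\max(\Lambda):=\max(P)$. -}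

module Defs where

open import Data.Nat using (ℕ; zero; suc)
open import Data.Integer using (ℤ; +_) renaming (_≤_ to _≤ℤ_)
open import Data.Fin using (Fin; toℕ; _<_)
open import Data.Fin.Subset using (Subset; _∈_)
open import Data.Vec using (Vec; lookup)
open import Data.Bool using (Bool; true)
open import Data.Product using (Σ; _×_; ∃)
open import Relation.Binary.PropositionalEquality using (_≡_)
open import Relation.Nullary using (¬_)
open import Function.Bundles using (_⇔_)

-- Partitions of [n] = Fin n, encoded as the "same block" relation,
-- given as an n×n Boolean matrix which must be an equivalence relation.
-- (Partitions of [n] correspond bijectively to equivalence relations on [n];
-- blocks are the equivalence classes.)

Rel : ℕ → Set
Rel n = Vec (Vec Bool n) n

Same : ∀ {n} → Rel n → Fin n → Fin n → Set
Same R i j = lookup (lookup R i) j ≡ true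

IsPartition : ∀ {n} → Rel n → Set
IsPartition {n} R =
  (∀ i → Same R i i) ×
  (∀ i j → Same R i j → Same R j i) ×
  (∀ i j l → Same R i j → Same R j l → Same R i l)

IsArc : ∀ {n} → Rel n → Fin n → Fin n → Set
IsArc R i j = Same R i j × i < j × (∀ l → Same R i l → i < l → ¬ (l < j))

IsMin : ∀ {n} → Rel n → Fin n → Set
IsMin R i = ∀ l → Same R i l → ¬ (l < i)

IsMax : ∀ {n} → Rel n → Fin n → Set
IsMax R i = ∀ l → Same R i l → ¬ (i < l)

-- r-colored partitions.  Every element i that is not maximal in its block
-- is the left end of exactly one arc; the colour of that arc is stored at
-- position i of a vector col.  Positions i ∈ max(P) carry no arc, and
-- their entry is normalised to colour 0 so that the encoding
-- (R , col)  ↦  (P , φ)  is a bijection onto r-colored partitions.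

Carrier : ℕ → ℕ → Set
Carrier n r = Rel n × Vec (Fin r) n

IsColoredPartition : ∀ {n r} → Carrier n r → Set
IsColoredPartition (R Data.Product., col) =
  IsPartition R × (∀ i → IsMax R i → toℕ (lookup col i) ≡ 0)

colour : ∀ {n r} → Carrier n r → Fin n → Fin r
colour (R Data.Product., col) i = lookup col i

rel : ∀ {n r} → Carrier n r → Rel n
rel (R Data.Product., col) = R

HasCrossing : ∀ {n r} → Carrier n r → ℕ → Set
HasCrossing {n} Λ k =
  Σ (Fin k → Fin n) λ a → Σ (Fin k → Fin n) λ b →
    (∀ t → IsArc (rel Λ) (a t) (b t)) ×
    (∀ s t → colour Λ (a s) ≡ colour Λ (a t)) ×
    (∀ s t → s < t → a s < a t) ×
    (∀ s t → a s < b t) ×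
    (∀ s t → s < t → b s < b t)

HasNesting : ∀ {n r} → Carrier n r → ℕ → Set
HasNesting {n} Λ k =
  Σ (Fin k → Fin n) λ a → Σ (Fin k → Fin n) λ b →
    (∀ t → IsArc (rel Λ) (a t) (b t)) ×
    (∀ s t → colour Λ (a s) ≡ colour Λ (a t)) ×
    (∀ s t → s < t → a s < a t) ×
    (∀ s t → a s < b t) ×
    (∀ s t → s < t → b t < b s)

-- cr(Λ) < j  (cr(Λ) is the largest k with a k-crossing; a 0-crossing
-- always exists).  Unfolded: no m-crossing for any m with j ≤ m.
CrLt : ∀ {n r} → Carrier n r → ℤ → Set
CrLt Λ j = ∀ (m : ℕ) → j ≤ℤ + m → ¬ HasCrossing Λ m

NeLt : ∀ {n r} → Carrier n r → ℤ → Set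
NeLt Λ k = ∀ (m : ℕ) → k ≤ℤ + m → ¬ HasNesting Λ m

MinIs : ∀ {n r} → Carrier n r → Subset n → Set
MinIs Λ S = ∀ i → (i ∈ S ⇔ IsMin (rel Λ) i)

MaxIs : ∀ {n r} → Carrier n r → Subset n → Set
MaxIs Λ T = ∀ i → (i ∈ T ⇔ IsMax (rel Λ) i)

NCNSet : (n r : ℕ) → ℤ → ℤ → Subset n → Subset n → Carrier n r → Set
NCNSet n r j k S T Λ =
  IsColoredPartition Λ × CrLt Λ j × NeLt Λ k × MinIs Λ S × MaxIs Λ T

SameCount : {X : Set} → (X → Set) → (X → Set) → Set
SameCount {X} P Q =
  Σ (X → X) λ f → Σ (X → X) λ g →
    (∀ x → P x → Q (f x)) ×
    (∀ x → Q x → P (g x)) ×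
    (∀ x → P x → g (f x) ≡ x) ×
    (∀ x → Q x → f (g x) ≡ x)

{-# OPTIONS --safe #-}
module Submission where

-- Arcs of different colours do not interact, so fix a colour and record its arcs
-- (i , j) as points (i , n − 1 − j) of the staircase {(i , m) : i + m + 2 ≤ n}.
-- Fomin's growth diagram attaches to every lattice point (x , z) a Young diagram
-- whose first row is the longest nesting, and whose first column is the longest
-- crossing, among the arcs with i < x ≤ j, where x + z = n.  The local rules are
-- invertible, so the diagrams along the outer boundary determine the arcs.
-- Conjugating these boundary diagrams is therefore an involution; it exchanges
-- nestings with crossings, and it keeps the left and right endpoints of the arcs
-- because these are the boundary steps at which a box is added or removed.

-- A crossing or nesting has all its left ends before all its right ends, so some cut `x` lies under
-- all its arcs, and the rectangle below the boundary corner at `x` contains it whole; this is why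
-- boundary diagrams see every one. The first row is read by walking back from the corner. The first
-- column is reached one Viennot layer at a time: a decreasing chain of k + 1 cells in layer r gives
-- one of k cells in layer r + 1, and k + 1 cells in layer r + 1 give k + 2 in layer r. So row k is
-- nonempty exactly when there are k + 1 decreasing points. The colours are dualised one by one, and
-- the obstacle is to fit the results into one partition. It works because each colour keeps its own
-- openers and closers: no element gets two arcs out or two arcs in, and the colour vector can stay.
-- The involution is not calculated. Duality is a relation that is symmetric, by conjugating twice,
-- and functional, because boundary labels determine the filling; so applying the map twice has only
-- one possible result.

open import Defs
open import Data.Bool using (Bool; true; false)
import Data.Bool.Properties as Bool
open import Data.Empty using (⊥; ⊥-elim)
open import Data.Fin as Fin using (Fin; toℕ; opposite; fromℕ<)
import Data.Fin.Properties as Fin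
open import Data.Fin.Subset using (Subset)
open import Data.Integer using (ℤ)
open import Data.Maybe using (Maybe; just; nothing)
open import Data.Nat using (ℕ; zero; suc; _+_; _∸_; _≤_; _<_; z≤n; s≤s; _≤′_; ≤′-refl; ≤′-step)
open import Data.Nat.Properties
open import Data.Product using (Σ; ∃; _×_; _,_; proj₁; proj₂)
open import Data.Sum using (_⊎_; inj₁; inj₂)
open import Data.Vec using (lookup; tabulate)
open import Data.Vec.Functional using (_∷_)
open import Data.Vec.Properties using (lookup∘tabulate)
open import Data.Vec.Relation.Binary.Pointwise.Extensional using (ext; Pointwise-≡⇒≡)
open import Function.Base using (_∘_)
open import Function.Bundles using (mk⇔; Equivalence)
open import Relation.Binary.Definitions using (tri<; tri≈; tri>)
open import Relation.Binary.PropositionalEquality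
open import Relation.Nullary using (¬_; yes; no; Dec; does)
open import Relation.Nullary.Decidable using (_×-dec_; _→-dec_; ¬?; dec-true)

-- Growth diagrams

-- The row of the box by which the diagrams at the two ends of an edge differ;
-- `nothing` if they agree.
Label : Set
Label = Maybe ℕ

-- Two unlabelled edges count as different here, so `pass` also covers a cell in which nothing
-- changes.
_#_ : Label → Label → Set
e # f = ∀ r → e ≡ just r → f ≡ just r → ⊥

#-sym : ∀ {e f} → e # f → f # e
#-sym e#f r p q = e#f r q p

-- Fomin's local rule, as Cell bottom left bit top right.
data Cell : Label → Label → Bool → Label → Label → Set where
  point : Cell nothing nothing true (just 0) (just 0)
  bump  : ∀ r → Cell (just r) (just r) false (just (suc r)) (just (suc r))
  pass  : ∀ {e f} → e # f → Cell e f false e f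

meet? : ∀ e f → (∃ λ r → e ≡ just r × f ≡ just r) ⊎ e # f
meet? nothing  f        = inj₂ λ _ ()
meet? (just _) nothing  = inj₂ λ _ _ ()
meet? (just s) (just t) with s ≟ t
... | yes refl = inj₁ (s , refl , refl)
... | no s≢t   = inj₂ λ { _ refl refl → s≢t refl }

cell-transpose : ∀ {e f b e′ f′} → Cell e f b e′ f′ → Cell f e b f′ e′
cell-transpose point      = point
cell-transpose (bump r)   = bump r
cell-transpose (pass e#f) = pass (#-sym e#f)

fwd : Label → Label → Bool → Label × Label
fwd e f true = just 0 , just 0
fwd e f false with meet? e f
... | inj₁ (r , _) = just (suc r) , just (suc r)
... | inj₂ _       = e , f

-- With at most one point per row and column the side condition holds, as a label can only start at
-- an earlier point of the same column or row.
fwd-cell : ∀ e f b → (b ≡ true → e ≡ nothing × f ≡ nothing) →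
           Cell e f b (proj₁ (fwd e f b)) (proj₂ (fwd e f b))
fwd-cell e f true free with free refl
... | refl , refl = point
fwd-cell e f false free with meet? e f
... | inj₁ (r , refl , refl) = bump r
... | inj₂ e#f               = pass e#f

-- Traces a label back towards a point while `Cell` is not yet available; `forward` uses this to
-- discharge the side condition of `fwd-cell`.
fwd-just : ∀ e f b →
  (∀ r → proj₁ (fwd e f b) ≡ just r → b ≡ true ⊎ (∃ λ s → e ≡ just s)) ×
  (∀ r → proj₂ (fwd e f b) ≡ just r → b ≡ true ⊎ (∃ λ s → f ≡ just s))
fwd-just e f true = (λ _ _ → inj₁ refl) , (λ _ _ → inj₁ refl)
fwd-just e f false with meet? e f
... | inj₁ (r , p , q) = (λ _ _ → inj₂ (r , p)) , (λ _ _ → inj₂ (r , q))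
... | inj₂ _           = (λ r p → inj₂ (r , p)) , (λ r p → inj₂ (r , p))

bwd : Label → Label → Label × Label × Bool
bwd e f with meet? e f
... | inj₁ (zero  , _) = nothing , nothing , true
... | inj₁ (suc r , _) = just r , just r , false
... | inj₂ _           = e , f , false

-- No side condition on the labels: `just 0` on both outputs comes from `point` alone. Any labelling
-- of the boundary can therefore be continued inwards.
bwd-cell : ∀ e f → Cell (proj₁ (bwd e f)) (proj₁ (proj₂ (bwd e f))) (proj₂ (proj₂ (bwd e f))) e f
bwd-cell e f with meet? e f
... | inj₁ (zero  , refl , refl) = point
... | inj₁ (suc r , refl , refl) = bump r
... | inj₂ e#f                   = pass e#f

cell-deterministic : ∀ {e f b e₁ f₁ e₂ f₂} → Cell e f b e₁ f₁ → Cell e f b e₂ f₂ → e₁ ≡ e₂ × f₁ ≡ f₂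
cell-deterministic point      point      = refl , refl
cell-deterministic (bump r)   (bump .r)  = refl , refl
cell-deterministic (bump r)   (pass e#f) = ⊥-elim (e#f r refl refl)
cell-deterministic (pass e#f) (bump r)   = ⊥-elim (e#f r refl refl)
cell-deterministic (pass _)   (pass _)   = refl , refl

cell-reversible : ∀ {e₁ f₁ b₁ e₂ f₂ b₂ e f} → Cell e₁ f₁ b₁ e f → Cell e₂ f₂ b₂ e f →
                  e₁ ≡ e₂ × f₁ ≡ f₂ × b₁ ≡ b₂
cell-reversible point      point      = refl , refl , refl
cell-reversible point      (pass e#f) = ⊥-elim (e#f 0 refl refl)
cell-reversible (bump r)   (bump .r)  = refl , refl , refl
cell-reversible (bump r)   (pass e#f) = ⊥-elim (e#f (suc r) refl refl)
cell-reversible (pass e#f) point      = ⊥-elim (e#f 0 refl refl)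
cell-reversible (pass e#f) (bump r)   = ⊥-elim (e#f (suc r) refl refl)
cell-reversible (pass _)   (pass _)   = refl , refl , refl

-- Layer r of Viennot's shadow construction: layer 0 consists of the points of
-- the filling, layer r + 1 of the cells where row r bumps a box into the next row.
At : ℕ → Label → Label → Bool → Set
At zero    e f b = b ≡ true
At (suc r) e f b = e ≡ just r × f ≡ just r

At-out : ∀ r {e f b e′ f′} → Cell e f b e′ f′ → At r e f b → e′ ≡ just r × f′ ≡ just r
At-out zero    point      _           = refl , refl
At-out (suc r) (bump .r)  (refl , _)  = refl , refl
At-out (suc r) (pass e#f) (p , q)     = ⊥-elim (e#f r p q)

out-origin : ∀ {e f b e′ f′ r} → Cell e f b e′ f′ → e′ ≡ just r →
             (e ≡ just r × ¬ f ≡ just r) ⊎ At r e f b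
out-origin point      refl = inj₂ refl
out-origin (bump r)   refl = inj₂ (refl , refl)
out-origin (pass e#f) p    = inj₁ (p , e#f _ p)

in-fate : ∀ {e f b e′ f′ r} → Cell e f b e′ f′ → e ≡ just r → e′ ≡ just r ⊎ At (suc r) e f b
in-fate (bump r) refl = inj₂ (refl , refl)
in-fate (pass _) p    = inj₁ p

kron : ℕ → ℕ → ℕ
kron zero    zero    = 1
kron zero    (suc _) = 0
kron (suc _) zero    = 0
kron (suc s) (suc r) = kron s r

kron-refl : ∀ r → kron r r ≡ 1
kron-refl zero    = refl
kron-refl (suc r) = kron-refl r

kron-cases : ∀ s r → kron s r ≡ 0 ⊎ s ≡ r
kron-cases zero    zero    = inj₂ refl
kron-cases zero    (suc _) = inj₁ refl
kron-cases (suc _) zero    = inj₁ refl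
kron-cases (suc s) (suc r) with kron-cases s r
... | inj₁ p = inj₁ p
... | inj₂ p = inj₂ (cong suc p)

kron-≢ : ∀ {s r} → ¬ s ≡ r → kron s r ≡ 0
kron-≢ {s} {r} s≢r with kron-cases s r
... | inj₁ p = p
... | inj₂ p = ⊥-elim (s≢r p)

δ : Label → ℕ → ℕ
δ nothing  _ = 0
δ (just s) r = kron s r

δ-cases : ∀ e r → δ e r ≡ 0 ⊎ e ≡ just r
δ-cases nothing  r = inj₁ refl
δ-cases (just s) r with kron-cases s r
... | inj₁ p    = inj₁ p
... | inj₂ refl = inj₂ refl

δ-just : ∀ {e r} → e ≡ just r → δ e r ≡ 1
δ-just {r = r} refl = kron-refl r

δ-≢ : ∀ {e r} → ¬ e ≡ just r → δ e r ≡ 0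
δ-≢ {e} {r} e≢r with δ-cases e r
... | inj₁ p = p
... | inj₂ p = ⊥-elim (e≢r p)

δ-null : ∀ e → (∀ r → δ e r ≡ 0) → e ≡ nothing
δ-null nothing  _ = refl
δ-null (just s) h with trans (sym (kron-refl s)) (h s)
... | ()

δ-injective : ∀ e f → (∀ r → δ e r ≡ δ f r) → e ≡ f
δ-injective nothing  f h = sym (δ-null f (λ r → sym (h r)))
δ-injective (just s) f h with δ-cases f s
... | inj₂ p = sym p
... | inj₁ p with trans (sym (kron-refl s)) (trans (h s) p)
...   | ()

-- The two routes around a cell, left then top and bottom then right, add the same boxes.
cell-conserve : ∀ {e f b e′ f′} → Cell e f b e′ f′ → ∀ r → δ e′ r + δ f r ≡ δ f′ r + δ e r
cell-conserve point            r = refl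
cell-conserve (bump s)         r = refl
cell-conserve (pass {e} {f} _) r = +-comm (δ e r) (δ f r)

-- Young diagrams around one cell

Shape : Set
Shape = ℕ → ℕ

Step : Shape → Label → Shape → Set
Step S ℓ S′ = ∀ r → S′ r ≡ δ ℓ r + S r

IsPart : Shape → Set
IsPart S = ∀ r → S (suc r) ≤ S r

step-unique : ∀ {S S′ ℓ ℓ′} → Step S ℓ S′ → Step S ℓ′ S′ → ℓ ≡ ℓ′
step-unique {S} {ℓ = ℓ} {ℓ′} p q = δ-injective ℓ ℓ′ λ r →
  +-cancelʳ-≡ (S r) (δ ℓ r) (δ ℓ′ r) (trans (sym (p r)) (q r))

step-cong : ∀ {S S₁ S′ S₁′ ℓ} → (∀ r → S r ≡ S₁ r) → (∀ r → S′ r ≡ S₁′ r) → Step S ℓ S′ → Step S₁ ℓ S₁′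
step-cong {ℓ = ℓ} p q st r = trans (sym (q r)) (trans (st r) (cong (δ ℓ r +_) (p r)))

step-grows : ∀ {S S′ ℓ} → Step S ℓ S′ → ∀ r → S r ≤ S′ r
step-grows {S} {ℓ = ℓ} st r = subst (S r ≤_) (sym (st r)) (m≤n+m (S r) (δ ℓ r))

part-antitone : ∀ {S} → IsPart S → ∀ {r r′} → r ≤ r′ → S r′ ≤ S r
part-antitone {S} p {r} r≤r′ = go (≤⇒≤′ r≤r′)
  where
  go : ∀ {r′} → r ≤′ r′ → S r′ ≤ S r
  go ≤′-refl       = ≤-refl
  go (≤′-step r≤′) = ≤-trans (p _) (go r≤′)

-- Only the row receiving the box of `e′` can break monotonicity. In `bump s` the row before it has
-- itself grown from `ρ` to `ν`; in `pass` the receiving row is untouched by `f`, so its new length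
-- is the one in `μ`.
part-cell : ∀ {e f b e′ f′} → Cell e f b e′ f′ → ∀ {ρ μ ν} →
            Step ρ e μ → Step ρ f ν → IsPart ρ → IsPart μ → IsPart ν →
            IsPart (λ r → δ e′ r + ν r)
part-cell point {ρ} {μ} {ν} sμ sν pρ pμ pν t = ≤-trans (pν t) (m≤n+m (ν t) (kron 0 t))
part-cell (bump s) {ρ} {μ} {ν} sμ sν pρ pμ pν t with kron-cases s t
... | inj₁ k rewrite k = ≤-trans (pν t) (m≤n+m (ν t) _)
... | inj₂ refl = begin
    kron s s + ν (suc s)                        ≡⟨ cong₂ _+_ (kron-refl s) (trans (sν (suc s)) (cong (_+ ρ (suc s)) (kron-≢ (<⇒≢ (n<1+n s))))) ⟩
    suc (ρ (suc s))                             ≤⟨ s≤s (pρ s) ⟩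
    suc (ρ s)                                   ≡⟨ cong (_+ ρ s) (sym (kron-refl s)) ⟩
    kron s s + ρ s                              ≡⟨ sym (sν s) ⟩
    ν s                                         ≤⟨ m≤n+m (ν s) _ ⟩
    kron (suc s) s + ν s                        ∎
  where open ≤-Reasoning
part-cell (pass {e} {f} e#f) {ρ} {μ} {ν} sμ sν pρ pμ pν t with δ-cases e (suc t)
... | inj₁ k rewrite k = ≤-trans (pν t) (m≤n+m (ν t) _)
... | inj₂ k = begin
    δ e (suc t) + ν (suc t)                     ≡⟨ cong (δ e (suc t) +_) (trans (sν (suc t)) (cong (_+ ρ (suc t)) (δ-≢ (e#f _ k)))) ⟩
    δ e (suc t) + ρ (suc t)                     ≡⟨ sym (sμ (suc t)) ⟩
    μ (suc t)                                   ≤⟨ pμ t ⟩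
    μ t                                         ≡⟨ sμ t ⟩
    δ e t + ρ t                                 ≤⟨ +-monoʳ-≤ (δ e t) (step-grows {ℓ = f} sν t) ⟩
    δ e t + ν t                                 ∎
  where open ≤-Reasoning

-- The converse of `part-cell`: the fourth diagram is `μ` without the box of `e`. By `room` the
-- truncated subtraction is exact, and `tight` treats the one row whose shortening could break
-- monotonicity.
module BackCell {e f b e′ f′} (c : Cell e f b e′ f′) {λ′ μ ν : Shape}
  (sν : Step ν e′ λ′) (sμ : Step μ f′ λ′) (pλ : IsPart λ′) (pμ : IsPart μ) (pν : IsPart ν) where

  ρ : Shape
  ρ r = μ r ∸ δ e r

  private
    room : ∀ {e f b e′ f′} → Cell e f b e′ f′ → Step ν e′ λ′ → Step μ f′ λ′ → ∀ {r} → e ≡ just r → 1 ≤ μ r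
    room (bump s) sν sμ refl = begin
        1                              ≤⟨ s≤s z≤n ⟩
        suc (μ (suc s))                ≡⟨ cong (_+ μ (suc s)) (sym (kron-refl s)) ⟩
        kron s s + μ (suc s)           ≡⟨ sym (sμ (suc s)) ⟩
        λ′ (suc s)                     ≤⟨ pλ s ⟩
        λ′ s                           ≡⟨ sμ s ⟩
        kron (suc s) s + μ s           ≡⟨ cong (_+ μ s) (kron-≢ (≢-sym (<⇒≢ (n<1+n s)))) ⟩
        μ s                            ∎
      where open ≤-Reasoning
    room (pass {e} {f} e#f) sν sμ {r} refl = begin
        1                              ≤⟨ s≤s z≤n ⟩
        suc (ν r)                      ≡⟨ cong (_+ ν r) (sym (kron-refl r)) ⟩
        kron r r + ν r                 ≡⟨ sym (sν r) ⟩
        λ′ r                           ≡⟨ sμ r ⟩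
        δ f r + μ r                    ≡⟨ cong (_+ μ r) (δ-≢ {f} (e#f r refl)) ⟩
        μ r                            ∎
      where open ≤-Reasoning

    δ≤μ : ∀ r → δ e r ≤ μ r
    δ≤μ r with δ-cases e r
    ... | inj₁ k rewrite k = z≤n
    ... | inj₂ k = subst (_≤ μ r) (sym (δ-just k)) (room c sν sμ k)

  stepH : Step ρ e μ
  stepH r = sym (m+[n∸m]≡n (δ≤μ r))

  stepV : Step ρ f ν
  stepV r = +-cancelˡ-≡ (δ e′ r) (ν r) (δ f r + ρ r) (begin
      δ e′ r + ν r                ≡⟨ sym (sν r) ⟩
      λ′ r                        ≡⟨ sμ r ⟩
      δ f′ r + μ r                ≡⟨ cong (δ f′ r +_) (stepH r) ⟩
      δ f′ r + (δ e r + ρ r)      ≡⟨ sym (+-assoc (δ f′ r) (δ e r) (ρ r)) ⟩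
      δ f′ r + δ e r + ρ r        ≡⟨ cong (_+ ρ r) (sym (cell-conserve c r)) ⟩
      δ e′ r + δ f r + ρ r        ≡⟨ +-assoc (δ e′ r) (δ f r) (ρ r) ⟩
      δ e′ r + (δ f r + ρ r)      ∎)
    where open ≡-Reasoning

  private
    tight : ∀ {e f b e′ f′} → Cell e f b e′ f′ → Step ρ f ν → Step μ f′ λ′ →
            ∀ t → e ≡ just t → μ t ≡ suc (ρ t) → ρ (suc t) ≤ μ (suc t) → ρ (suc t) ≤ ρ t
    tight (bump s) sV sμ .s refl eq le = ≤-pred (begin
        suc (ρ (suc s))                ≤⟨ s≤s le ⟩
        suc (μ (suc s))                ≡⟨ cong (_+ μ (suc s)) (sym (kron-refl s)) ⟩
        kron s s + μ (suc s)           ≡⟨ sym (sμ (suc s)) ⟩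
        λ′ (suc s)                     ≤⟨ pλ s ⟩
        λ′ s                           ≡⟨ sμ s ⟩
        kron (suc s) s + μ s           ≡⟨ cong (_+ μ s) (kron-≢ (≢-sym (<⇒≢ (n<1+n s)))) ⟩
        μ s                            ≡⟨ eq ⟩
        suc (ρ s)                      ∎)
      where open ≤-Reasoning
    tight (pass {e} {f} e#f) sV sμ t k eq le = begin
        ρ (suc t)                      ≤⟨ step-grows {ℓ = f} sV (suc t) ⟩
        ν (suc t)                      ≤⟨ pν t ⟩
        ν t                            ≡⟨ sV t ⟩
        δ f t + ρ t                    ≡⟨ cong (_+ ρ t) (δ-≢ (e#f t k)) ⟩
        ρ t                            ∎
      where open ≤-Reasoning

  part : IsPart ρ
  part t with δ-cases e t
  ... | inj₁ k = begin
      μ (suc t) ∸ δ e (suc t)          ≤⟨ m∸n≤m (μ (suc t)) (δ e (suc t)) ⟩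
      μ (suc t)                        ≤⟨ pμ t ⟩
      μ t                              ≡⟨ cong (μ t ∸_) (sym k) ⟩
      μ t ∸ δ e t                      ∎
    where open ≤-Reasoning
  ... | inj₂ k = tight c stepV sμ t k (trans (stepH t) (cong (_+ ρ t) (δ-just k))) (m∸n≤m (μ (suc t)) (δ e (suc t)))

-- H i m labels the edge (i , m) – (i + 1 , m) and V i m the edge (i , m) – (i , m + 1).
record Growth (n : ℕ) (B : ℕ → ℕ → Bool) : Set where
  field
    H V    : ℕ → ℕ → Label
    H-base : ∀ i → i < n → H i 0 ≡ nothing
    V-base : ∀ m → m < n → V 0 m ≡ nothing
    cell   : ∀ i m → suc (i + m) < n → Cell (H i m) (V i m) (B i m) (H i (suc m)) (V (suc i) m)

  P : ℕ → ℕ → ℕ → Set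
  P r i m = At r (H i m) (V i m) (B i m)

-- The local rules are symmetric in the two axes, so what is proved for columns and `H` also serves
-- for rows and `V`.
transpose : ∀ {n B} → Growth n B → Growth n (λ m i → B i m)
transpose {n} G = record
  { H = λ m i → V i m ; V = λ m i → H i m
  ; H-base = V-base ; V-base = H-base
  ; cell = λ m i lt → cell-transpose (cell i m (subst (λ k → suc k < n) (+-comm m i) lt))
  }
  where open Growth G

-- Only labels are stored; a diagram is the total of the boxes met on the way right from the empty
-- diagram at `(0 , z)`. That the vertical labels fit is `shape-V`.
shape : (ℕ → ℕ → Label) → ℕ → ℕ → Shape
shape H zero    z r = 0
shape H (suc x) z r = δ (H x z) r + shape H x z r

cell-inside : ∀ {n i m x z} → i < x → m < z → x + z ≤ n → suc (i + m) < n
cell-inside {n} {i} {m} i<x m<z le = ≤-trans (≤-reflexive (cong suc (sym (+-suc i m)))) (≤-trans (+-mono-≤ i<x m<z) le)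

edge-inside : ∀ {n i m x z} → i < x → m ≤ z → x + z ≤ n → i + m < n
edge-inside i<x m≤z le = ≤-trans (+-mono-≤ i<x m≤z) le

-- Following a label through its column

module Tracing {n B} (G : Growth n B) where
  open Growth G

  -- Descend while the label stays `just r`: by `out-origin` the descent ends only at a cell of
  -- layer `r`, and it must end since the base is unlabelled. `between-up` uses the constancy above
  -- that cell.
  H-origin : ∀ i m {r} → i + m < n → H i m ≡ just r →
             ∃ λ y → y < m × P r i y × (∀ y′ → y < y′ → y′ ≤ m → H i y′ ≡ just r)
  H-origin i zero lt p with trans (sym p) (H-base i (subst (_< n) (+-identityʳ i) lt))
  ... | ()
  H-origin i (suc m) lt p with subst (_< n) (+-suc i m) lt
  ... | lt′ with out-origin (cell i m lt′) p
  ...   | inj₂ q = m , ≤-refl , q , λ y′ y<y′ y′≤ → subst (λ y → H i y ≡ _) (≤-antisym y<y′ y′≤) p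
  ...   | inj₁ (q , _) with H-origin i m (<⇒≤ lt′) q
  ...     | y , y<m , py , between = y , m<n⇒m<1+n y<m , py , λ y′ y<y′ y′≤ → extend y′ y<y′ (m≤n⇒m<n∨m≡n y′≤)
    where
    extend : ∀ y′ → y < y′ → y′ < suc m ⊎ y′ ≡ suc m → H i y′ ≡ just _
    extend y′ y<y′ (inj₁ lt″)  = between y′ y<y′ (≤-pred lt″)
    extend _  _    (inj₂ refl) = p

  H-fate : ∀ i {y z r} → i + z < n → y ≤ z → H i y ≡ just r →
           H i z ≡ just r ⊎ (∃ λ y′ → y ≤ y′ × y′ < z × P (suc r) i y′)
  H-fate i {y} lt y≤z p = go (≤⇒≤′ y≤z) lt
    where
    go : ∀ {z} → y ≤′ z → i + z < n → H i z ≡ just _ ⊎ (∃ λ y′ → y ≤ y′ × y′ < z × P (suc _) i y′)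
    go ≤′-refl _ = inj₁ p
    go (≤′-step {z} y≤′z) lt with subst (_< n) (+-suc i z) lt
    ... | lt′ with go y≤′z (<⇒≤ lt′)
    ...   | inj₂ (y′ , a , b , q) = inj₂ (y′ , a , m<n⇒m<1+n b , q)
    ...   | inj₁ q with in-fate (cell i z lt′) q
    ...     | inj₁ q′ = inj₁ q′
    ...     | inj₂ q′ = inj₂ (z , ≤′⇒≤ y≤′z , ≤-refl , q′)

  H-persists : ∀ i {y z r} → i + z < n → y ≤ z → H i y ≡ just r → ∃ λ s → H i z ≡ just s
  H-persists i {y} lt y≤z p = go (≤⇒≤′ y≤z) lt
    where
    go : ∀ {z} → y ≤′ z → i + z < n → ∃ λ s → H i z ≡ just s
    go ≤′-refl _ = _ , p
    go (≤′-step {z} y≤′z) lt with subst (_< n) (+-suc i z) lt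
    ... | lt′ with go y≤′z (<⇒≤ lt′)
    ...   | s , q with in-fate (cell i z lt′) q
    ...     | inj₁ q′ = s , q′
    ...     | inj₂ q′ = suc s , proj₁ (At-out (suc s) (cell i z lt′) q′)

  H-opened : ∀ i m {r} → i + m < n → H i m ≡ just r → ∃ λ y → y < m × B i y ≡ true
  H-opened i m {zero} lt p with H-origin i m lt p
  ... | y , y<m , q , _ = y , y<m , q
  H-opened i m {suc r} lt p with H-origin i m lt p
  ... | y , y<m , (q , _) , _ with H-opened i y (≤-<-trans (+-monoʳ-≤ i (<⇒≤ y<m)) lt) q
  ...   | y′ , y′<y , q′ = y′ , <-trans y′<y y<m , q′

  -- Label `r` takes `r` bumps at distinct lower heights, after the point that opened the column.
  H-label-bound : ∀ i m {r} → i + m < n → H i m ≡ just r → r < m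
  H-label-bound i m {zero} lt p with H-origin i m lt p
  ... | y , y<m , _ = ≤-trans (s≤s z≤n) y<m
  H-label-bound i m {suc r} lt p with H-origin i m lt p
  ... | y , y<m , (q , _) , _ = ≤-trans (s≤s (H-label-bound i y (≤-<-trans (+-monoʳ-≤ i (<⇒≤ y<m)) lt) q)) y<m

  H-free : ∀ i m → suc (i + m) < n → B i m ≡ true → H i m ≡ nothing
  H-free i m lt p with cell i m lt
  ... | c with H i m | V i m | B i m | H i (suc m) | V (suc i) m
  H-free i m lt refl | point | _ | _ | _ | _ | _ = refl

  -- After a point the column stays labelled, whereas a second point would need `nothing`. Applied
  -- to the dual filling, this makes the new arcs of one colour a matching.
  col-unique : ∀ i m m′ → suc (i + m) < n → suc (i + m′) < n → B i m ≡ true → B i m′ ≡ true → m ≤ m′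
  col-unique i m m′ lt lt′ p q with <-≤-connex m′ m
  ... | inj₂ m≤m′ = m≤m′
  ... | inj₁ m′<m with H-persists i {suc m′} {m} (<⇒≤ lt) m′<m (proj₁ (At-out 0 (cell i m′ lt′) q))
  ...   | s , h with trans (sym h) (H-free i m lt p)
  ...     | ()

  -- Labels never vanish, so the openers can be read off the boundary; `boundary-opened` is the
  -- other direction.
  boundary-label : ∀ i m → suc (i + m) < n → B i m ≡ true → ∃ λ y → suc (i + y) ≡ n × ∃ λ s → H i y ≡ just s
  boundary-label i m lt p =
    n ∸ suc i , eq , H-persists i (≤-reflexive eq) m<y (proj₁ (At-out 0 (cell i m lt) p))
    where
    eq : suc i + (n ∸ suc i) ≡ n
    eq = m+[n∸m]≡n (≤-trans (s≤s (m≤m+n i m)) (<⇒≤ lt))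
    m<y : suc m ≤ n ∸ suc i
    m<y = subst (_≤ n ∸ suc i) (m+n∸m≡n (suc i) (suc m))
            (∸-monoˡ-≤ (suc i) (subst (_≤ n) (cong suc (sym (+-suc i m))) lt))

  boundary-opened : ∀ i y {r} → suc (i + y) ≡ n → H i y ≡ just r → ∃ λ m → suc (i + m) < n × B i m ≡ true
  boundary-opened i y eq p with H-opened i y (≤-reflexive eq) p
  ... | m , m<y , b = m , cell-inside ≤-refl m<y (≤-reflexive eq) , b

module Shapes {n B} (G : Growth n B) where
  open Growth G
  open Tracing G

  shape-V : ∀ x z → x + z < n → Step (shape H x z) (V x z) (shape H x (suc z))
  shape-V zero    z lt r rewrite V-base z lt = refl
  shape-V (suc x) z lt r = begin
      δ H′ r + shape H x (suc z) r             ≡⟨ cong (δ H′ r +_) (shape-V x z (<⇒≤ lt) r) ⟩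
      δ H′ r + (δ (V x z) r + shape H x z r)   ≡⟨ sym (+-assoc (δ H′ r) _ _) ⟩
      δ H′ r + δ (V x z) r + shape H x z r     ≡⟨ cong (_+ shape H x z r) (cell-conserve (cell x z lt) r) ⟩
      δ V′ r + δ (H x z) r + shape H x z r     ≡⟨ +-assoc (δ V′ r) _ _ ⟩
      δ V′ r + (δ (H x z) r + shape H x z r)   ∎
    where
    open ≡-Reasoning
    H′ = H x (suc z)
    V′ = V (suc x) z

  shape-mono-x : ∀ {x x′} z r → x ≤ x′ → shape H x z r ≤ shape H x′ z r
  shape-mono-x {x} z r le = go (≤⇒≤′ le)
    where
    go : ∀ {x′} → x ≤′ x′ → shape H x z r ≤ shape H x′ z r
    go ≤′-refl      = ≤-refl
    go (≤′-step le) = ≤-trans (go le) (m≤n+m _ _)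

  shape-mono-z : ∀ x {z z′} r → x + z′ ≤ n → z ≤ z′ → shape H x z r ≤ shape H x z′ r
  shape-mono-z x {z} r = λ le z≤z′ → go (≤⇒≤′ z≤z′) le
    where
    go : ∀ {z′} → z ≤′ z′ → x + z′ ≤ n → shape H x z r ≤ shape H x z′ r
    go ≤′-refl            _  = ≤-refl
    go (≤′-step {z′} z≤′) le with subst (_≤ n) (+-suc x z′) le
    ... | lt = ≤-trans (go z≤′ (<⇒≤ lt)) (step-grows {ℓ = V x z′} (shape-V x z′ lt) r)

  shape-base : ∀ x r → x ≤ n → shape H x 0 r ≡ 0
  shape-base zero    r _  = refl
  shape-base (suc x) r lt rewrite H-base x lt = shape-base x r (<⇒≤ lt)

  shape-part : ∀ x z → x + z ≤ n → IsPart (shape H x z)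
  shape-part zero    z       le r = z≤n
  shape-part (suc x) zero    le r =
    ≤-reflexive (trans (shape-base (suc x) (suc r) le′) (sym (shape-base (suc x) r le′)))
    where le′ = subst (_≤ n) (+-identityʳ (suc x)) le
  shape-part (suc x) (suc z) le with subst (_≤ n) (cong suc (+-suc x z)) le
  ... | lt = part-cell (cell x z lt) (λ _ → refl) (shape-V x z (<⇒≤ lt))
               (shape-part x z (<⇒≤ (<⇒≤ lt)))
               (shape-part (suc x) z (<⇒≤ lt))
               (shape-part x (suc z) (<⇒≤ le))

  shape-≤ : ∀ x z r → shape H x z r ≤ x
  shape-≤ zero    z r = z≤n
  shape-≤ (suc x) z r with δ-cases (H x z) r
  ... | inj₁ k rewrite k        = m≤n⇒m≤1+n (shape-≤ x z r)
  ... | inj₂ k rewrite δ-just k = s≤s (shape-≤ x z r)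

  shape-entry : ∀ x z r → 0 < shape H x z r → ∃ λ i → i < x × H i z ≡ just r
  shape-entry (suc x) z r pos with δ-cases (H x z) r
  ... | inj₂ k = x , ≤-refl , k
  ... | inj₁ k rewrite k with shape-entry x z r pos
  ...   | i , i<x , p = i , m<n⇒m<1+n i<x , p

  -- Finiteness of the diagrams, which `IsPart` leaves open and `conj-involutive` asks for.
  shape-vanish : ∀ x z r → x + z ≤ n → z ≤ r → shape H x z r ≡ 0
  shape-vanish x z r le z≤r with shape H x z r in eq
  ... | zero  = refl
  ... | suc _ with shape-entry x z r (subst (0 <_) (sym eq) (s≤s z≤n))
  ...   | i , i<x , p = ⊥-elim (<⇒≱ (H-label-bound i z (edge-inside i<x ≤-refl le) p) z≤r)

-- Chains of points against the first row and the first column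

data IncChain (B : ℕ → ℕ → Bool) : ℕ → ℕ → ℕ → Set where
  nil  : ∀ {x z} → IncChain B 0 x z
  snoc : ∀ {k x z i m} → IncChain B k i m → B i m ≡ true → i < x → m < z → IncChain B (suc k) x z

-- Points are added rightwards and downwards: the newest one governs the bound `x` and the floor
-- `y`, while all share the ceiling `z`. `Q` is arbitrary because chains of different layers are
-- compared.
data DecChain (Q : ℕ → ℕ → Set) (z : ℕ) : ℕ → ℕ → ℕ → Set where
  nil  : ∀ {x y} → DecChain Q z 0 x y
  snoc : ∀ {k x y i m} → DecChain Q z k i (suc m) → Q i m → i < x → y ≤ m → m < z → DecChain Q z (suc k) x y

IncChain-weaken : ∀ {B k x z x′ z′} → x ≤ x′ → z ≤ z′ → IncChain B k x z → IncChain B k x′ z′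
IncChain-weaken _  _  nil              = nil
IncChain-weaken xx zz (snoc c p i<x m<z) = snoc c p (≤-trans i<x xx) (≤-trans m<z zz)

DecChain-weaken : ∀ {Q z k x y x′ y′} → x ≤ x′ → y′ ≤ y → DecChain Q z k x y → DecChain Q z k x′ y′
DecChain-weaken _  _  nil                     = nil
DecChain-weaken xx yy (snoc c p i<x y≤m m<z) = snoc c p (≤-trans i<x xx) (≤-trans yy y≤m) m<z

module Nesting {n B} (G : Growth n B) where
  open Growth G
  open Tracing G
  open Shapes G

  -- Every point puts `just 0` on top of its cell, one more box in the first row than at the cell's
  -- lower left corner.
  IncChain⇒shape : ∀ {k x z} → x + z ≤ n → IncChain B k x z → k ≤ shape H x z 0
  IncChain⇒shape le nil = z≤n
  IncChain⇒shape {suc k} {x} {z} le (snoc {i = i} {m} c p i<x m<z) = begin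
      suc k                              ≤⟨ s≤s (IncChain⇒shape (<⇒≤ (<⇒≤ lt)) c) ⟩
      suc (shape H i m 0)                ≤⟨ s≤s (step-grows {ℓ = V i m} (shape-V i m (<⇒≤ lt)) 0) ⟩
      suc (shape H i (suc m) 0)          ≡⟨ cong (_+ shape H i (suc m) 0) (sym (δ-just (proj₁ (At-out 0 (cell i m lt) p)))) ⟩
      shape H (suc i) (suc m) 0          ≤⟨ shape-mono-x (suc m) 0 i<x ⟩
      shape H x (suc m) 0                ≤⟨ shape-mono-z x 0 le m<z ⟩
      shape H x z 0                      ∎
    where
    open ≤-Reasoning
    lt = cell-inside i<x m<z le

  -- Walk back from `(x , z)`, left or down, while the first row keeps its length. Where neither
  -- step applies the corner cell holds a point; its left edge is unlabelled, so dropping its row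
  -- and column shortens the first row by exactly one.
  shape⇒IncChain : ∀ k x z → x + z ≤ n → k ≤ shape H x z 0 → IncChain B k x z
  shape⇒IncChain zero    x       z       le _ = nil
  shape⇒IncChain (suc k) (suc x) zero    le h with subst (suc k ≤_) (shape-base (suc x) 0 (subst (_≤ n) (+-identityʳ (suc x)) le)) h
  ... | ()
  shape⇒IncChain (suc k) (suc x) (suc z) le h with δ-cases (H x (suc z)) 0
  ... | inj₁ e rewrite e = IncChain-weaken (n≤1+n x) ≤-refl (shape⇒IncChain (suc k) x (suc z) (<⇒≤ le) h)
  ... | inj₂ e with subst (_≤ n) (cong suc (+-suc x z)) le
  ...   | lt with out-origin (cell x z lt) e
  ...     | inj₂ p = snoc (shape⇒IncChain k x z (<⇒≤ (<⇒≤ lt)) k≤) p ≤-refl ≤-refl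
    where
    V≡ : shape H x (suc z) 0 ≡ shape H x z 0
    V≡ = trans (shape-V x z (<⇒≤ lt) 0) (cong (_+ shape H x z 0) (δ-≢ (λ v → no-V v)))
      where
      no-V : ¬ V x z ≡ just 0
      no-V v with trans (sym v) (Tracing.H-free (transpose G) z x (subst (λ s → suc s < n) (+-comm x z) lt) p)
      ... | ()
    k≤ : k ≤ shape H x z 0
    k≤ = ≤-pred (subst (suc k ≤_) (cong₂ _+_ (δ-just e) V≡) h)
  ...     | inj₁ (e′ , v) = IncChain-weaken ≤-refl (n≤1+n z) (shape⇒IncChain (suc k) (suc x) z (<⇒≤ lt) k≤)
    where
    k≤ : suc k ≤ shape H (suc x) z 0
    k≤ = subst (suc k ≤_) (cong₂ _+_ (trans (δ-just e) (sym (δ-just e′)))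
           (trans (shape-V x z (<⇒≤ lt) 0) (cong (_+ shape H x z 0) (δ-≢ v)))) h

module Crossing {n B} (G : Growth n B) where
  open Growth G
  open Tracing G
  open Shapes G
  private module Gᵀ = Tracing (transpose G)

  swap-< : ∀ {x y} → x + y < n → y + x < n
  swap-< {x} {y} = subst (_< n) (+-comm x y)

  V-fate : ∀ m {x w r} → w + m < n → x ≤ w → V x m ≡ just r →
           V w m ≡ just r ⊎ (∃ λ x′ → x ≤ x′ × x′ < w × P (suc r) x′ m)
  V-fate m {w = w} lt x≤w p with Gᵀ.H-fate m (swap-< {w} lt) x≤w p
  ... | inj₁ q                       = inj₁ q
  ... | inj₂ (x′ , a , b , (q , q′)) = inj₂ (x′ , a , b , (q′ , q))

  -- Transposition swaps the two components of `At (suc r)` but fixes `At zero`, hence the split on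
  -- `r`.
  V-origin : ∀ x m {r} → x + m < n → V x m ≡ just r →
             ∃ λ w → w < x × P r w m × (∀ w′ → w < w′ → w′ ≤ x → V w′ m ≡ just r)
  V-origin x m {zero}  lt p = Gᵀ.H-origin m x (swap-< {x} lt) p
  V-origin x m {suc r} lt p with Gᵀ.H-origin m x (swap-< {x} lt) p
  ... | w , w<x , (q , q′) , between = w , w<x , (q′ , q) , between

  -- Follow row r to the right from (i , m) and upwards from (i′ , m′): the two
  -- paths meet at (i′ , m) unless one of them is bumped before.
  between-down : ∀ r {i m i′ m′} → i < i′ → m′ < m → i′ + m < n → suc (i + m) < n → suc (i′ + m′) < n →
                 P r i m → P r i′ m′ → ∃ λ x → ∃ λ y → i < x × x ≤ i′ × m′ < y × y ≤ m × P (suc r) x y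
  between-down r {i} {m} {i′} {m′} i<i′ m′<m lt lt₁ lt₂ p p′
    with H-fate i′ lt m′<m (proj₁ (At-out r (cell i′ m′ lt₂) p′))
       | V-fate m lt i<i′ (proj₂ (At-out r (cell i m lt₁) p))
  ... | inj₂ (y , a , b , q) | _                    = i′ , y , i<i′ , ≤-refl , a , <⇒≤ b , q
  ... | inj₁ _               | inj₂ (x , a , b , q) = x , m , a , <⇒≤ b , m′<m , ≤-refl , q
  ... | inj₁ h               | inj₁ v               = i′ , m , i<i′ , ≤-refl , m′<m , ≤-refl , (h , v)

  -- Trace both bumps back to the points of layer r that started them.  If neither
  -- lay in the box, the two traces would already have met at (i , m′).
  between-up : ∀ r {i m i′ m′} → i < i′ → m′ < m → i′ + m < n →
               P (suc r) i m → P (suc r) i′ m′ → ∃ λ x → ∃ λ y → i ≤ x × x < i′ × m′ ≤ y × y < m × P r x y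
  between-up r {i} {m} {i′} {m′} i<i′ m′<m lt (h , _) (_ , v′)
    with H-origin i m (<-trans (+-monoˡ-< m i<i′) lt) h | V-origin i′ m′ (<-trans (+-monoʳ-< i′ m′<m) lt) v′
  ... | y , y<m , p , H-between | x , x<i′ , q , V-between with ≤-<-connex i x | ≤-<-connex m′ y
  ...   | inj₁ i≤x | _         = x , m′ , i≤x , x<i′ , ≤-refl , m′<m , q
  ...   | inj₂ _   | inj₁ m′≤y = i , y , ≤-refl , i<i′ , m′≤y , y<m , p
  ...   | inj₂ x<i | inj₂ y<m′ with trans (sym (H-between (suc m′) (m<n⇒m<1+n y<m′) m′<m))
                                     (proj₁ (At-out (suc r) (cell i m′ lt′)
                                       (H-between m′ y<m′ (<⇒≤ m′<m) , V-between i x<i (<⇒≤ i<i′))))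
    where lt′ = cell-inside (i<i′) (m′<m) (<⇒≤ lt)
  ...     | ()

  -- Each consecutive pair yields one bump, in a box that is open on the left and below but closed
  -- on the other sides; so bumps of neighbouring pairs are again strictly decreasing.
  down : ∀ r {z k i m} → suc i + z ≤ n → m < z → DecChain (P r) z k i (suc m) → P r i m →
         DecChain (P (suc r)) z k (suc i) (suc m)
  down r le m<z nil p = nil
  down r {z} {i = i} {m} le m<z (snoc {i = i₁} {m₁} c p₁ i₁<i m<m₁ m₁<z) p
    with between-down r i₁<i m<m₁ (edge-inside ≤-refl (<⇒≤ m₁<z) le) (cell-inside (m<n⇒m<1+n i₁<i) m₁<z le)
           (cell-inside ≤-refl m<z le) p₁ p
  ... | x , y , i₁<x , x≤i , m<y , y≤m₁ , q =
    snoc (DecChain-weaken i₁<x (s≤s y≤m₁) (down r (≤-trans (+-monoˡ-≤ z (<⇒≤ (s≤s i₁<i))) le) m₁<z c p₁))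
         q (s≤s x≤i) m<y (≤-<-trans y≤m₁ m₁<z)

  -- One cell per consecutive pair, now in boxes closed on the left and below, plus one at each end:
  -- the leftmost cell is traced back along its row here, the rightmost down its column in
  -- `DecChain-up`.
  up : ∀ r {z k i m} → suc i + z ≤ n → m < z → DecChain (P (suc r)) z k i (suc m) → P (suc r) i m →
       DecChain (P r) z (suc k) i m
  up r {i = i} {m} le m<z nil (_ , v) with V-origin i m (edge-inside ≤-refl (<⇒≤ m<z) le) v
  ... | x , x<i , q , _ = snoc nil q x<i ≤-refl m<z
  up r {z} {i = i} {m} le m<z (snoc {i = i₁} {m₁} c p₁ i₁<i m<m₁ m₁<z) p
    with between-up r i₁<i m<m₁ (edge-inside ≤-refl (<⇒≤ m₁<z) le) p₁ p
  ... | x , y , i₁≤x , x<i , m≤y , y<m₁ , q =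
    snoc (DecChain-weaken i₁≤x y<m₁ (up r (≤-trans (+-monoˡ-≤ z (<⇒≤ (s≤s i₁<i))) le) m₁<z c p₁))
         q x<i m≤y (<-trans y<m₁ m₁<z)

  DecChain-down : ∀ r {x z k} → x + z ≤ n → DecChain (P r) z (suc k) x 0 → DecChain (P (suc r)) z k x 0
  DecChain-down r {z = z} le (snoc c p i<x _ m<z) =
    DecChain-weaken i<x z≤n (down r (≤-trans (+-monoˡ-≤ z i<x) le) m<z c p)

  DecChain-up : ∀ r {x z k} → x + z ≤ n → DecChain (P (suc r)) z (suc k) x 0 → DecChain (P r) z (suc (suc k)) x 0
  DecChain-up r {z = z} le (snoc {i = i} {m} c p@(h , _) i<x _ m<z)
    with H-origin i m (edge-inside i<x (<⇒≤ m<z) le) h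
  ... | y , y<m , q , _ =
    snoc (DecChain-weaken ≤-refl y<m (up r (≤-trans (+-monoˡ-≤ z i<x) le) m<z c p)) q i<x z≤n (<-trans y<m m<z)

  -- Descending `k` layers leaves a single cell of layer `k + r`, and such a cell puts a box into
  -- row `k + r`.
  DecChain⇒shape : ∀ k r {x z} → x + z ≤ n → DecChain (P r) z (suc k) x 0 → 0 < shape H x z (k + r)
  DecChain⇒shape zero r {x} {z} le (snoc {i = i} {m} _ p i<x _ m<z) = begin
      1                                  ≤⟨ s≤s z≤n ⟩
      1 + shape H i (suc m) r            ≡⟨ cong (_+ shape H i (suc m) r) (sym (δ-just (proj₁ (At-out r (cell i m (cell-inside i<x m<z le)) p)))) ⟩
      shape H (suc i) (suc m) r          ≤⟨ shape-mono-x (suc m) r i<x ⟩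
      shape H x (suc m) r                ≤⟨ shape-mono-z x r le m<z ⟩
      shape H x z r                      ∎
    where open ≤-Reasoning
  DecChain⇒shape (suc k) r {x} {z} le c =
    subst (λ s → 0 < shape H x z s) (+-suc k r) (DecChain⇒shape k (suc r) le (DecChain-down r le c))

  shape⇒DecChain : ∀ k r {x z} → x + z ≤ n → 0 < shape H x z (k + r) → DecChain (P r) z (suc k) x 0
  shape⇒DecChain zero r {x} {z} le pos with shape-entry x z r pos
  ... | i , i<x , h with H-origin i z (edge-inside i<x ≤-refl le) h
  ...   | y , y<z , p , _ = snoc nil p i<x z≤n y<z
  shape⇒DecChain (suc k) r {x} {z} le pos =
    DecChain-up r le (shape⇒DecChain k (suc r) le (subst (λ s → 0 < shape H x z s) (sym (+-suc k r)) pos))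

-- Conjugation and duality

-- The indicator of `c < s`, so that `conj n S c` counts those of the first `n` rows that reach
-- column `c`.
less : ℕ → ℕ → ℕ
less _       zero    = 0
less zero    (suc _) = 1
less (suc c) (suc s) = less c s

less-suc : ∀ c s → less c (suc s) ≡ kron s c + less c s
less-suc zero    zero    = refl
less-suc (suc _) zero    = refl
less-suc zero    (suc _) = refl
less-suc (suc c) (suc s) = less-suc c s

less-< : ∀ {c s} → c < s → less c s ≡ 1
less-< {zero}  (s≤s _)  = refl
less-< {suc c} (s≤s lt) = less-< lt

less-≥ : ∀ {c s} → s ≤ c → less c s ≡ 0
less-≥ {c} z≤n      = refl
less-≥     (s≤s le) = less-≥ le

less-antitone : ∀ c s → less (suc c) s ≤ less c s
less-antitone c       zero    = z≤n
less-antitone zero    (suc zero)    = z≤n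
less-antitone zero    (suc (suc s)) = ≤-refl
less-antitone (suc c) (suc s) = less-antitone c s

conj : ℕ → Shape → Shape
conj zero    S c = 0
conj (suc n) S c = less c (S n) + conj n S c

conj-cong : ∀ n {S S′} → (∀ r → S r ≡ S′ r) → ∀ c → conj n S c ≡ conj n S′ c
conj-cong zero    eq c = refl
conj-cong (suc n) eq c = cong₂ _+_ (cong (less c) (eq n)) (conj-cong n eq c)

conj-part : ∀ n S → IsPart (conj n S)
conj-part zero    S c = z≤n
conj-part (suc n) S c = +-mono-≤ (less-antitone c (S n)) (conj-part n S c)

conj-null : ∀ n {S} → (∀ r → S r ≡ 0) → ∀ c → conj n S c ≡ 0
conj-null zero        h c = refl
conj-null (suc n) {S} h c rewrite h n = conj-null n h c

conj-full : ∀ n {S c} → (∀ r → r < n → c < S r) → conj n S c ≡ n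
conj-full zero    h = refl
conj-full (suc n) h = cong₂ _+_ (less-< (h n ≤-refl)) (conj-full n (λ r lt → h r (m<n⇒m<1+n lt)))

conj-≤ : ∀ n S c → conj n S c ≤ n
conj-≤ zero    S c = z≤n
conj-≤ (suc n) S c with <-≤-connex c (S n)
... | inj₁ lt rewrite less-< lt = s≤s (conj-≤ n S c)
... | inj₂ ge rewrite less-≥ ge = m≤n⇒m≤1+n (conj-≤ n S c)

-- The rows longer than `c` form an initial segment. Together with `<-conj⇐` this says that
-- conjugation reflects boxes, and two reflections give `conj-involutive`.
<-conj⇒ : ∀ n {S c r} → IsPart S → r < conj n S c → c < S r
<-conj⇒ (suc n) {S} {c} {r} p lt with <-≤-connex c (S n)
... | inj₁ c<  = <-≤-trans c< (part-antitone p (≤-pred (≤-trans lt (conj-≤ (suc n) S c))))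
... | inj₂ c≥ rewrite less-≥ c≥ = <-conj⇒ n p lt

<-conj⇐ : ∀ n {S c r} → IsPart S → r < n → c < S r → r < conj n S c
<-conj⇐ (suc n) {S} {c} {r} p r<n c< with <-≤-connex c (S n)
... | inj₁ c<n = subst (r <_) (sym (conj-full (suc n)
                   (λ q lt → <-≤-trans c<n (part-antitone p (≤-pred lt))))) r<n
... | inj₂ c≥ rewrite less-≥ c≥ = <-conj⇐ n p (≤∧≢⇒< (≤-pred r<n) λ { refl → <⇒≱ c< c≥ }) c<

≡-from-< : ∀ a b → (∀ c → c < a → c < b) → (∀ c → c < b → c < a) → a ≡ b
≡-from-< a b f g = ≤-antisym (go a b f) (go b a g)
  where
  go : ∀ a b → (∀ c → c < a → c < b) → a ≤ b
  go zero    b f = z≤n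
  go (suc a) b f = f a ≤-refl

conj-involutive : ∀ n {S} → IsPart S → (∀ r → S r ≤ n) → (∀ r → n ≤ r → S r ≡ 0) →
                  ∀ r → conj n (conj n S) r ≡ S r
conj-involutive n {S} p bound vanish r = ≡-from-< _ _
  (λ c lt → <-conj⇒ n p (<-conj⇒ n (conj-part n S) lt))
  (λ c lt → <-conj⇐ n (conj-part n S) (<-≤-trans lt (bound r)) (<-conj⇐ n p (r<n c lt) lt))
  where
  r<n : ∀ c → c < S r → r < n
  r<n c lt with <-≤-connex r n
  ... | inj₁ r<n = r<n
  ... | inj₂ n≤r = ⊥-elim (n≮0 (subst (c <_) (vanish r n≤r) lt))

-- `S` is the diagram before the box is added: a box appended to row `r` lands in column `S r`, its
-- row after conjugation.
colLabel : Shape → Label → Label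
colLabel S nothing  = nothing
colLabel S (just r) = just (S r)

-- Only the summand of row `r` changes, by the indicator of column `S r` (`less-suc`); `below`
-- treats the partial sums without it, `at` those containing it.
conj-step : ∀ n {S ℓ S′} → (∀ r → ℓ ≡ just r → r < n) → Step S ℓ S′ →
            Step (conj n S) (colLabel S ℓ) (conj n S′)
conj-step n {S} {nothing} {S′} _     st c = conj-cong n st c
conj-step n {S} {just r}  {S′} bound st c = at n (bound r refl)
  where
  below : ∀ k → k ≤ r → conj k S′ c ≡ conj k S c
  below zero    _  = refl
  below (suc k) le = cong₂ (λ s t → less c s + t)
    (trans (st k) (cong (_+ S k) (kron-≢ (≢-sym (<⇒≢ le))))) (below k (<⇒≤ le))
  at : ∀ k → r < k → conj k S′ c ≡ kron (S r) c + conj k S c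
  at (suc k) r<k with m≤n⇒m<n∨m≡n (≤-pred r<k)
  ... | inj₂ refl = begin
      less c (S′ k) + conj k S′ c              ≡⟨ cong₂ (λ s t → less c s + t) (trans (st k) (cong (_+ S k) (kron-refl k))) (below k ≤-refl) ⟩
      less c (suc (S k)) + conj k S c          ≡⟨ cong (_+ conj k S c) (less-suc c (S k)) ⟩
      kron (S k) c + less c (S k) + conj k S c ≡⟨ +-assoc (kron (S k) c) _ _ ⟩
      kron (S k) c + conj (suc k) S c          ∎
    where open ≡-Reasoning
  ... | inj₁ r<k′ = begin
      less c (S′ k) + conj k S′ c                   ≡⟨ cong₂ (λ s t → less c s + t) (trans (st k) (cong (_+ S k) (kron-≢ (<⇒≢ r<k′)))) (at k r<k′) ⟩
      less c (S k) + (kron (S r) c + conj k S c)    ≡⟨ sym (+-assoc (less c (S k)) _ _) ⟩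
      less c (S k) + kron (S r) c + conj k S c      ≡⟨ cong (_+ conj k S c) (+-comm (less c (S k)) _) ⟩
      kron (S r) c + less c (S k) + conj k S c      ≡⟨ +-assoc (kron (S r) c) _ _ ⟩
      kron (S r) c + conj (suc k) S c               ∎
    where open ≡-Reasoning

-- Reconstructing a growth from its boundary

module Reverse (n : ℕ) (h v : ℕ → Label) where

  -- Corners and edges at distance d from the boundary are indexed by d and x only,
  -- since z = n − d − x (for edges z = n − d − x − 1).
  mutual
    Hr Vr : ℕ → ℕ → Label
    Hr zero    x = h x
    Hr (suc d) x = proj₁ (back d x)
    Vr zero    x = v x
    Vr (suc d) x = proj₁ (proj₂ (back d x))

    back : ℕ → ℕ → Label × Label × Bool
    back d x = bwd (Hr d x) (Vr d (suc x))

  bit : ℕ → ℕ → Bool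
  -- `level` truncates to 0 on and beyond the boundary, where there is no cell; the default `false`
  -- is what yields `bits-support`.
  bit zero    x = false
  bit (suc d) x = proj₂ (proj₂ (back d x))

  level : ℕ → ℕ → ℕ
  level i m = n ∸ suc (i + m)

  bits : ℕ → ℕ → Bool
  bits i m = bit (level i m) i

  level-suc : ∀ x → x < n → n ∸ x ≡ suc (n ∸ suc x)
  level-suc x lt = +-∸-assoc 1 lt

  bits-support : ∀ i m → bits i m ≡ true → suc (i + m) < n
  bits-support i m p with <-≤-connex (suc (i + m)) n
  ... | inj₁ lt = lt
  ... | inj₂ ge with subst (λ d → bit d i ≡ true) (m≤n⇒m∸n≡0 ge) p
  ...   | ()

  -- The boundary is a zigzag: `T x` sits at `(x , n − x)` and `U x` at `(x , n − x − 1)`. From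
  -- `U x` the edge `h x` leads right to `T (suc x)` and `v x` leads up to `T x`.
  module Grow (T U : ℕ → Shape)
    (stepH : ∀ x → x < n → Step (U x) (h x) (T (suc x)))
    (stepV : ∀ x → x < n → Step (U x) (v x) (T x))
    (partT : ∀ x → x ≤ n → IsPart (T x))
    (partU : ∀ x → x < n → IsPart (U x))
    (T-start : ∀ r → T 0 r ≡ 0)
    (T-end : ∀ r → T n r ≡ 0) where

    S : ℕ → ℕ → Shape
    S zero          x   = T x
    S (suc zero)    x   = U x
    S (suc (suc d)) x r = S (suc d) (suc x) r ∸ δ (Hr (suc d) x) r

    -- Two consecutive levels are carried together because `BackCell` takes `λ′` from one and `μ`,
    -- `ν` from the next.
    Valid : ℕ → Set
    Valid d = (∀ x → x + d ≤ n → IsPart (S d x)) ×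
              (∀ x → x + suc d ≤ n → IsPart (S (suc d) x)
                                    × Step (S (suc d) x) (Hr d x) (S d (suc x))
                                    × Step (S (suc d) x) (Vr d x) (S d x))

    valid : ∀ d → Valid d
    valid zero = (λ x le → partT x (subst (_≤ n) (+-identityʳ x) le)) ,
                 (λ x le → let lt = subst (_≤ n) (+-comm x 1) le in partU x lt , stepH x lt , stepV x lt)
    valid (suc d) with valid d
    ... | pd , vd = (λ x le → proj₁ (vd x le)) , next
      where
      next : ∀ x → x + suc (suc d) ≤ n → IsPart (S (suc (suc d)) x)
               × Step (S (suc (suc d)) x) (Hr (suc d) x) (S (suc d) (suc x))
               × Step (S (suc (suc d)) x) (Vr (suc d) x) (S (suc d) x)
      next x le = BC.part , BC.stepH , BC.stepV
        where
        le₁ : suc x + suc d ≤ n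
        le₁ = subst (_≤ n) (+-suc x (suc d)) le
        le₀ : x + suc d ≤ n
        le₀ = <⇒≤ le₁
        module BC = BackCell (bwd-cell (Hr d x) (Vr d (suc x)))
          (proj₁ (proj₂ (vd x le₀))) (proj₂ (proj₂ (vd (suc x) le₁)))
          (pd (suc x) (subst (_≤ n) (+-suc x d) le₀)) (proj₁ (vd (suc x) le₁)) (proj₁ (vd x le₀))

    step-null : ∀ {S S′ : Shape} {ℓ} → Step S ℓ S′ → (∀ r → S′ r ≡ 0) → ℓ ≡ nothing × (∀ r → S r ≡ 0)
    step-null {ℓ = ℓ} st z = δ-null ℓ (λ r → m+n≡0⇒m≡0 (δ ℓ r) (trans (sym (st r)) (z r))) ,
                             (λ r → m+n≡0⇒n≡0 (δ ℓ r) (trans (sym (st r)) (z r)))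

    -- Diagrams only shrink away from the boundary, so the empty `T 0` empties the whole left edge,
    -- and `T n` the bottom edge in `bottom-null`. This gives `V-base` and `H-base`.
    left-null : ∀ d → d ≤ n → ∀ r → S d 0 r ≡ 0
    left-null zero    _  = T-start
    left-null (suc d) le = proj₂ (step-null {ℓ = Vr d 0} (proj₂ (proj₂ (proj₂ (valid d) 0 le))) (left-null d (<⇒≤ le)))

    bottom-null : ∀ d x → x + d ≡ n → ∀ r → S d x r ≡ 0
    bottom-null zero x eq r = subst (λ k → T k r ≡ 0) (trans (sym eq) (+-identityʳ x)) (T-end r)
    bottom-null (suc d) x eq = proj₂ (step-null {ℓ = Hr d x} (proj₁ (proj₂ (proj₂ (valid d) x (≤-reflexive eq))))
                                 (bottom-null d (suc x) (trans (sym (+-suc x d)) eq)))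

    growth : Growth n bits
    growth = record
      { H = λ i m → Hr (level i m) i
      ; V = λ i m → Vr (level i m) i
      ; H-base = λ i lt → subst (λ k → Hr (n ∸ suc k) i ≡ nothing) (sym (+-identityʳ i)) (H-null i lt)
      ; V-base = λ m lt → proj₁ (step-null (proj₂ (proj₂ (proj₂ (valid (n ∸ suc m)) 0 (V-le m lt))))
                                  (left-null (n ∸ suc m) (m∸n≤m n (suc m))))
      ; cell = cell′
      }
      where
      V-le : ∀ m → m < n → suc (n ∸ suc m) ≤ n
      V-le m lt = subst (_≤ n) (level-suc m lt) (m∸n≤m n m)
      H-null : ∀ i → i < n → Hr (n ∸ suc i) i ≡ nothing
      H-null i lt = proj₁ (step-null (proj₁ (proj₂ (proj₂ (valid (n ∸ suc i)) i (≤-reflexive eq))))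
                      (bottom-null (n ∸ suc i) (suc i) (m+[n∸m]≡n lt)))
        where
        eq : i + suc (n ∸ suc i) ≡ n
        eq = trans (+-suc i _) (m+[n∸m]≡n lt)
      cell′ : ∀ i m → suc (i + m) < n →
              Cell (Hr (level i m) i) (Vr (level i m) i) (bit (level i m) i) (Hr (level i (suc m)) i) (Vr (level (suc i) m) (suc i))
      cell′ i m lt rewrite +-suc i m | level-suc (suc (i + m)) lt =
        bwd-cell (Hr (n ∸ suc (suc (i + m))) i) (Vr (n ∸ suc (suc (i + m))) (suc i))

    shape-S : ∀ x z → x + z ≤ n → ∀ r → shape (Growth.H growth) x z r ≡ S (n ∸ (x + z)) x r
    shape-S zero    z le r = sym (left-null (n ∸ z) (m∸n≤m n z) r)
    shape-S (suc x) z le r = begin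
        δ ℓ r + shape (Growth.H growth) x z r      ≡⟨ cong (δ ℓ r +_) (shape-S x z (<⇒≤ le) r) ⟩
        δ ℓ r + S (n ∸ (x + z)) x r                ≡⟨ cong (λ d → δ ℓ r + S d x r) (level-suc (x + z) le) ⟩
        δ ℓ r + S (suc (level x z)) x r            ≡⟨ sym (proj₁ (proj₂ (proj₂ (valid (level x z)) x le′)) r) ⟩
        S (level x z) (suc x) r                    ∎
      where
      open ≡-Reasoning
      ℓ = Hr (level x z) x
      le′ : x + suc (level x z) ≤ n
      le′ = subst (λ d → x + d ≤ n) (level-suc (x + z) le)
              (≤-trans (+-monoˡ-≤ (n ∸ (x + z)) (m≤m+n x z)) (≤-reflexive (m+[n∸m]≡n (<⇒≤ le))))

    shape-T : ∀ x z → x + z ≡ n → ∀ r → shape (Growth.H growth) x z r ≡ T x r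
    shape-T x z eq r = trans (shape-S x z (≤-reflexive eq) r) (cong (λ d → S d x r) (m≤n⇒m∸n≡0 (≤-reflexive (sym eq))))

    shape-U : ∀ x z → suc (x + z) ≡ n → ∀ r → shape (Growth.H growth) x z r ≡ U x r
    shape-U x z eq r = trans (shape-S x z (<⇒≤ (≤-reflexive eq)) r) (cong (λ d → S d x r)
      (trans (level-suc (x + z) (≤-reflexive eq)) (cong suc (m≤n⇒m∸n≡0 (≤-reflexive (sym eq))))))

-- From a filling to its dual

module Forward (B : ℕ → ℕ → Bool) where

  mutual
    Hf Vf : ℕ → ℕ → Label
    Hf i zero    = nothing
    Hf i (suc m) = proj₁ (fwd (Hf i m) (Vf i m) (B i m))
    Vf zero    m = nothing
    Vf (suc i) m = proj₂ (fwd (Hf i m) (Vf i m) (B i m))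

  Hf-opened : ∀ i m {r} → Hf i m ≡ just r → ∃ λ y → y < m × B i y ≡ true
  Hf-opened i (suc m) p with proj₁ (fwd-just (Hf i m) (Vf i m) (B i m)) _ p
  ... | inj₁ q = m , ≤-refl , q
  ... | inj₂ (s , q) with Hf-opened i m q
  ...   | y , y<m , q′ = y , m<n⇒m<1+n y<m , q′

  Vf-opened : ∀ i m {r} → Vf i m ≡ just r → ∃ λ x → x < i × B x m ≡ true
  Vf-opened (suc i) m p with proj₂ (fwd-just (Hf i m) (Vf i m) (B i m)) _ p
  ... | inj₁ q = i , ≤-refl , q
  ... | inj₂ (s , q) with Vf-opened i m q
  ...   | x , x<i , q′ = x , m<n⇒m<1+n x<i , q′

record Matching (B : ℕ → ℕ → Bool) : Set where
  field
    col : ∀ i m m′ → B i m ≡ true → B i m′ ≡ true → m ≡ m′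
    row : ∀ i i′ m → B i m ≡ true → B i′ m ≡ true → i ≡ i′

forward : ∀ n {B} → Matching B → Growth n B
forward n {B} M = record
  { H = Hf ; V = Vf
  ; H-base = λ _ _ → refl ; V-base = λ _ _ → refl
  ; cell = λ i m _ → fwd-cell (Hf i m) (Vf i m) (B i m) λ p → H-free i m p , V-free i m p
  }
  where
  open Forward B
  open Matching M
  H-free : ∀ i m → B i m ≡ true → Hf i m ≡ nothing
  H-free i m p with Hf i m in eq
  ... | nothing = refl
  ... | just r with Hf-opened i m eq
  ...   | y , y<m , q = ⊥-elim (<⇒≢ y<m (col i y m q p))
  V-free : ∀ i m → B i m ≡ true → Vf i m ≡ nothing
  V-free i m p with Vf i m in eq
  ... | nothing = refl
  ... | just r with Vf-opened i m eq
  ...   | x , x<i , q = ⊥-elim (<⇒≢ x<i (row x i m q p))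

-- Only corners of the boundary zigzag are compared: inside, the diagrams of the two growths are in
-- general not conjugate. A relation is used so that the involution can follow from symmetry and
-- uniqueness.
record Dual (n : ℕ) (B B̃ : ℕ → ℕ → Bool) : Set where
  field
    G : Growth n B
    G̃ : Growth n B̃
    conj-shape : ∀ x z → x + z ≤ n → n ≤ suc (x + z) → ∀ r →
                 shape (Growth.H G̃) x z r ≡ conj n (shape (Growth.H G) x z) r

-- The new filling is computed from an arbitrary `B`, since the bijection must be total on
-- `Carrier`; `Matching` enters with `isDual`.
module Dualize (n : ℕ) (B : ℕ → ℕ → Bool) where
  open Forward B

  T U : ℕ → Shape
  T x = shape Hf x (n ∸ x)
  U x = shape Hf x (n ∸ suc x)

  h v : ℕ → Label
  h x = colLabel (U x) (Hf x (n ∸ suc x))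
  v x = colLabel (U x) (Vf x (n ∸ suc x))

  open Reverse n h v public using (bits; bits-support; level-suc)
  open Reverse n h v using (module Grow)

  isDual : Matching B → Dual n B bits
  isDual M = record { G = forward n M ; G̃ = growth ; conj-shape = corners }
    where
    F = forward n M
    open Shapes F
    open Tracing F
    module Fᵀ = Tracing (transpose F)
    inner : ∀ x → x < n → x + (n ∸ suc x) < n
    inner x lt = ≤-reflexive (m+[n∸m]≡n lt)
    U≤ : ∀ x → n ∸ suc x ≤ n
    U≤ x = m∸n≤m n (suc x)
    open Grow (λ x → conj n (T x)) (λ x → conj n (U x))
      (λ x lt → conj-step n {ℓ = Hf x (n ∸ suc x)}
        (λ r p → <-≤-trans (H-label-bound x _ (inner x lt) p) (U≤ x))
        (λ r → refl))
      (λ x lt → conj-step n {ℓ = Vf x (n ∸ suc x)}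
        (λ r p → <-trans (Fᵀ.H-label-bound (n ∸ suc x) x (subst (_< n) (+-comm x _) (inner x lt)) p) lt)
        (subst (λ k → Step (U x) (Vf x (n ∸ suc x)) (shape Hf x k)) (sym (level-suc x lt)) (shape-V x (n ∸ suc x) (inner x lt))))
      (λ x _ → conj-part n (T x))
      (λ x _ → conj-part n (U x))
      (conj-null n (λ _ → refl))
      (conj-null n (λ r → subst (λ k → shape Hf n k r ≡ 0) (sym (n∸n≡0 n)) (shape-base n r ≤-refl)))
    corners : ∀ x z → x + z ≤ n → n ≤ suc (x + z) → ∀ r →
              shape (Growth.H growth) x z r ≡ conj n (shape Hf x z) r
    corners x z le ge r with m≤n⇒m<n∨m≡n le
    ... | inj₁ lt = trans (shape-U x z eq r) (cong (λ k → conj n (shape Hf x k) r) z≡)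
      where
      eq : suc (x + z) ≡ n
      eq = ≤-antisym lt ge
      z≡ : n ∸ suc x ≡ z
      z≡ = trans (cong (_∸ suc x) (sym eq)) (m+n∸m≡n (suc x) z)
    ... | inj₂ eq = trans (shape-T x z eq r) (cong (λ k → conj n (shape Hf x k) r)
                      (trans (cong (_∸ x) (sym eq)) (m+n∸m≡n x z)))

opaque
  dualBits : ℕ → (ℕ → ℕ → Bool) → ℕ → ℕ → Bool
  dualBits n B = Dualize.bits n B

  dualBits-dual : ∀ {n B} → Matching B → Dual n B (dualBits n B)
  dualBits-dual {n} {B} = Dualize.isDual n B

  dualBits-support : ∀ n B i m → dualBits n B i m ≡ true → suc (i + m) < n
  dualBits-support n B = Dualize.bits-support n B

dual-sym : ∀ {n B B̃} → Dual n B B̃ → Dual n B̃ B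
dual-sym {n} D = record
  { G = G̃ ; G̃ = G
  ; conj-shape = λ x z le ge r → sym (trans (conj-cong n (conj-shape x z le ge) r)
      (conj-involutive n (shape-part x z le) (λ r → ≤-trans (shape-≤ x z r) (≤-trans (m≤m+n x z) le))
        (λ r n≤r → shape-vanish x z r le (≤-trans (≤-trans (m≤n+m z x) le) n≤r)) r))
  }
  where
  open Dual D
  open Shapes G

-- Uniqueness of the dual

Agree : ℕ → (B B′ : ℕ → ℕ → Bool) → Set
Agree n B B′ = ∀ i m → suc (i + m) < n → B i m ≡ B′ i m

module _ {n B B′} (G : Growth n B) (G′ : Growth n B′) where
  private
    module G  = Growth G
    module G′ = Growth G′

  growth-deterministic : Agree n B B′ → ∀ i m → i + m < n → G.H i m ≡ G′.H i m × G.V i m ≡ G′.V i m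
  growth-deterministic agree i m lt = Heq i m lt , Veq i m lt
    where
    Heq : ∀ i m → i + m < n → G.H i m ≡ G′.H i m
    Veq : ∀ i m → i + m < n → G.V i m ≡ G′.V i m
    both : ∀ i m → suc (i + m) < n → G.H i m ≡ G′.H i m → G.V i m ≡ G′.V i m →
           G.H i (suc m) ≡ G′.H i (suc m) × G.V (suc i) m ≡ G′.V (suc i) m
    both i m lt p q with G.cell i m lt
    ... | c rewrite p | q | agree i m lt = cell-deterministic c (G′.cell i m lt)
    Heq i zero    lt = trans (G.H-base i lt′) (sym (G′.H-base i lt′))
      where lt′ = subst (_< n) (+-identityʳ i) lt
    Heq i (suc m) lt = proj₁ (both i m lt′ (Heq i m (<⇒≤ lt′)) (Veq i m (<⇒≤ lt′)))
      where lt′ = subst (_< n) (+-suc i m) lt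
    Veq zero    m lt = trans (G.V-base m lt) (sym (G′.V-base m lt))
    Veq (suc i) m lt = proj₂ (both i m lt (Heq i m (<⇒≤ lt)) (Veq i m (<⇒≤ lt)))

  growth-reversible : (∀ i m → suc (i + m) ≡ n → G.H i m ≡ G′.H i m × G.V i m ≡ G′.V i m) → Agree n B B′
  growth-reversible boundary i m lt = bit≡ i m lt (edges _ i (suc m) (eq₁ i m lt)) (edges _ (suc i) m (eq₂ i m lt))
    where
    eq₂ : ∀ i m → suc (i + m) < n → suc (suc i + m) + (n ∸ suc (suc (i + m))) ≡ n
    eq₂ i m lt = m+[n∸m]≡n lt
    eq₁ : ∀ i m → suc (i + m) < n → suc (i + suc m) + (n ∸ suc (suc (i + m))) ≡ n
    eq₁ i m lt = trans (cong (λ k → suc k + (n ∸ suc (suc (i + m)))) (+-suc i m)) (m+[n∸m]≡n lt)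
    Eq : ℕ → ℕ → Set
    Eq i m = G.H i m ≡ G′.H i m × G.V i m ≡ G′.V i m
    back≡ : ∀ i m → suc (i + m) < n → Eq i (suc m) → Eq (suc i) m →
            G.H i m ≡ G′.H i m × G.V i m ≡ G′.V i m × B i m ≡ B′ i m
    back≡ i m lt (p , _) (_ , q) with G.cell i m lt
    ... | c rewrite p | q = cell-reversible c (G′.cell i m lt)
    bit≡ : ∀ i m → suc (i + m) < n → Eq i (suc m) → Eq (suc i) m → B i m ≡ B′ i m
    bit≡ i m lt p q = proj₂ (proj₂ (back≡ i m lt p q))
    edges : ∀ d i m → suc (i + m) + d ≡ n → Eq i m
    edges zero    i m eq = boundary i m (trans (sym (+-identityʳ _)) eq)
    edges (suc d) i m eq = proj₁ edge≡ , proj₁ (proj₂ edge≡)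
      where
      eqV : suc (suc i + m) + d ≡ n
      eqV = trans (sym (+-suc (suc (i + m)) d)) eq
      eqH : suc (i + suc m) + d ≡ n
      eqH = trans (cong (λ k → suc k + d) (+-suc i m)) eqV
      edge≡ = back≡ i m (subst (suc (suc (i + m)) ≤_) eqV (m≤m+n (suc (suc (i + m))) d))
                (edges d i (suc m) eqH) (edges d (suc i) m eqV)

shape-cong : ∀ {H H′ : ℕ → ℕ → Label} x z → (∀ i → i < x → H i z ≡ H′ i z) → ∀ r → shape H x z r ≡ shape H′ x z r
shape-cong zero    z eq r = refl
shape-cong (suc x) z eq r = cong₂ _+_ (cong (λ ℓ → δ ℓ r) (eq x ≤-refl)) (shape-cong x z (λ i lt → eq i (m<n⇒m<1+n lt)) r)

-- Agreeing fillings have equal labels, hence equal boundary diagrams and equal conjugates. By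
-- `step-unique` these give back the boundary labels, from which the cells are undone one by one.
dual-functional : ∀ {n B B′ B₁ B₂} → Dual n B B₁ → Dual n B′ B₂ → Agree n B B′ → Agree n B₁ B₂
dual-functional {n} D D′ agree = growth-reversible D.G̃ D′.G̃ labels
  where
  module D  = Dual D
  module D′ = Dual D′
  same : ∀ x z → x + z ≤ n → n ≤ suc (x + z) → ∀ r → shape (Growth.H D.G̃) x z r ≡ shape (Growth.H D′.G̃) x z r
  same x z le ge r = begin
      shape (Growth.H D.G̃) x z r              ≡⟨ D.conj-shape x z le ge r ⟩
      conj n (shape (Growth.H D.G) x z) r      ≡⟨ conj-cong n (shape-cong x z λ i lt →
                                                    proj₁ (growth-deterministic D.G D′.G agree i z (edge-inside lt ≤-refl le))) r ⟩
      conj n (shape (Growth.H D′.G) x z) r     ≡⟨ sym (D′.conj-shape x z le ge r) ⟩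
      shape (Growth.H D′.G̃) x z r             ∎
    where open ≡-Reasoning
  labels : ∀ i m → suc (i + m) ≡ n → Growth.H D.G̃ i m ≡ Growth.H D′.G̃ i m × Growth.V D.G̃ i m ≡ Growth.V D′.G̃ i m
  labels i m eq =
    step-unique {ℓ = Growth.H D.G̃ i m} {Growth.H D′.G̃ i m} (step-cong {ℓ = Growth.H D.G̃ i m}
      (same i m (<⇒≤ le) ge) (same (suc i) m le (m≤n⇒m≤1+n ge)) (λ _ → refl)) (λ _ → refl) ,
    step-unique {ℓ = Growth.V D.G̃ i m} {Growth.V D′.G̃ i m} (step-cong {ℓ = Growth.V D.G̃ i m}
      (same i m (<⇒≤ le) ge) (same i (suc m) (subst (_≤ n) (sym (+-suc i m)) le) (m≤n⇒m≤1+n (subst (n ≤_) (sym (+-suc i m)) ge)))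
      (Shapes.shape-V D.G̃ i m le)) (Shapes.shape-V D′.G̃ i m le)
    where
    le = ≤-reflexive eq
    ge = ≤-reflexive (sym eq)

dual-transport : ∀ {n B B₁ B₂} → Dual n B B₁ → Agree n B₁ B₂ → Dual n B B₂
dual-transport {n} {B₂ = B₂} D agree = record
  { G = G
  ; G̃ = record { H = H ; V = V ; H-base = H-base ; V-base = V-base
               ; cell = λ i m lt → subst (λ b → Cell (H i m) (V i m) b (H i (suc m)) (V (suc i) m)) (agree i m lt) (cell i m lt) }
  ; conj-shape = conj-shape
  }
  where
  open Dual D
  open Growth G̃

-- What duality keeps and what it exchanges

module _ {n B B̃} (D : Dual n B B̃) where
  open Dual D
  private
    module G  = Growth G
    module G̃  = Growth G̃

    -- Conjugation may change the row of a box but not whether there is one: if `ℓ₁` were `nothing`,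
    -- the two diagrams would coincide, and so would their conjugates.
    label-kept : ∀ {S S′ S₁ S₁′ : Shape} {ℓ ℓ₁ r} → Step S ℓ S′ → Step S₁ ℓ₁ S₁′ →
                 (∀ r → S r ≡ conj n S₁ r) → (∀ r → S′ r ≡ conj n S₁′ r) → ℓ ≡ just r → ∃ λ s → ℓ₁ ≡ just s
    label-kept {ℓ₁ = just s} _ _ _ _ _ = s , refl
    label-kept {S} {S′} {ℓ₁ = nothing} {r} st st₁ eq eq′ refl
      = ⊥-elim (1+n≢n (begin
          suc (S r)         ≡⟨ cong (_+ S r) (sym (kron-refl r)) ⟩
          kron r r + S r    ≡⟨ sym (st r) ⟩
          S′ r              ≡⟨ eq′ r ⟩
          conj n _ r        ≡⟨ conj-cong n st₁ r ⟩
          conj n _ r        ≡⟨ sym (eq r) ⟩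
          S r               ∎))
      where open ≡-Reasoning

  dual-opener : ∀ {i m} → suc (i + m) < n → B̃ i m ≡ true → ∃ λ m′ → suc (i + m′) < n × B i m′ ≡ true
  dual-opener {i} {m} lt p with Tracing.boundary-label G̃ i m lt p
  ... | y , eq , _ , q with label-kept {ℓ = G̃.H i y} {G.H i y} (λ _ → refl) (λ _ → refl)
                              (conj-shape i y (<⇒≤ (≤-reflexive eq)) (≤-reflexive (sym eq)))
                              (conj-shape (suc i) y (≤-reflexive eq) (m≤n⇒m≤1+n (≤-reflexive (sym eq)))) q
  ...   | _ , q′ = Tracing.boundary-opened G i y eq q′

  dual-closer : ∀ {i m} → suc (i + m) < n → B̃ i m ≡ true → ∃ λ i′ → suc (i′ + m) < n × B i′ m ≡ true
  dual-closer {i} {m} lt p with Tracing.boundary-label (transpose G̃) m i (subst (λ k → suc k < n) (+-comm i m) lt) p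
  ... | x , eqᵀ , _ , q = opened (label-kept {ℓ = G̃.V x m} {G.V x m} (Shapes.shape-V G̃ x m le) (Shapes.shape-V G x m le)
                              (conj-shape x m (<⇒≤ le) ge)
                              (conj-shape x (suc m) (subst (_≤ n) (sym (+-suc x m)) le)
                                (m≤n⇒m≤1+n (subst (n ≤_) (sym (+-suc x m)) ge))) q)
    where
    eq : suc (x + m) ≡ n
    eq = trans (cong suc (+-comm x m)) eqᵀ
    le = ≤-reflexive eq
    ge = ≤-reflexive (sym eq)
    opened : (∃ λ s → G.V x m ≡ just s) → ∃ λ i′ → suc (i′ + m) < n × B i′ m ≡ true
    opened (_ , q′) with Tracing.boundary-opened (transpose G) m x eqᵀ q′
    ... | i′ , lt′ , b = i′ , subst (λ k → suc k < n) (+-comm m i′) lt′ , b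

  -- A first row longer than `k` makes row `k` of the conjugate nonempty, which is the form in which
  -- a column length is read.
  IncChain⇒DecChain : ∀ {k x z} → x + z ≡ n → IncChain B (suc k) x z →
                      DecChain (λ i m → B̃ i m ≡ true) z (suc k) x 0
  IncChain⇒DecChain {k} {x} {z} eq c = Crossing.shape⇒DecChain G̃ k 0 le
    (subst (0 <_) (sym (trans (cong (shape G̃.H x z) (+-identityʳ k)) (conj-shape x z le (m≤n⇒m≤1+n (≤-reflexive (sym eq))) k)))
      (<-conj⇐ n (Shapes.shape-part G x z le) 0<n k<))
    where
    le = ≤-reflexive eq
    k< : k < shape G.H x z 0
    k< = Nesting.IncChain⇒shape G le c
    0<n : 0 < n
    0<n = ≤-trans (≤-trans (s≤s z≤n) (≤-trans k< (Shapes.shape-≤ G x z 0))) (≤-trans (m≤m+n x z) le)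

  DecChain⇒IncChain : ∀ {k x z} → x + z ≡ n → DecChain (λ i m → B i m ≡ true) z (suc k) x 0 →
                      IncChain B̃ (suc k) x z
  DecChain⇒IncChain {k} {x} {z} eq c = Nesting.shape⇒IncChain G̃ (suc k) x z le
    (subst (k <_) (sym (conj-shape x z le (m≤n⇒m≤1+n (≤-reflexive (sym eq))) 0))
      (<-conj⇐ n (Shapes.shape-part G x z le) k<n pos))
    where
    le = ≤-reflexive eq
    pos : 0 < shape G.H x z k
    pos = subst (λ s → 0 < shape G.H x z s) (+-identityʳ k) (Crossing.DecChain⇒shape G k 0 le c)
    k<n : k < n
    k<n with <-≤-connex k n
    ... | inj₁ lt = lt
    ... | inj₂ ge = ⊥-elim (n≮0 (subst (0 <_) (Shapes.shape-vanish G x z k le (≤-trans (≤-trans (m≤n+m z x) le) ge)) pos))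

  dual-col-unique : ∀ i m m′ → suc (i + m) < n → suc (i + m′) < n → B i m ≡ true → B i m′ ≡ true → m ≡ m′
  dual-col-unique i m m′ lt lt′ p q = ≤-antisym (Tracing.col-unique G i m m′ lt lt′ p q) (Tracing.col-unique G i m′ m lt′ lt q p)

  dual-row-unique : ∀ i i′ m → suc (i + m) < n → suc (i′ + m) < n → B i m ≡ true → B i′ m ≡ true → i ≡ i′
  dual-row-unique i i′ m lt lt′ p q =
    ≤-antisym (Gᵀ.col-unique m i i′ (swap i lt) (swap i′ lt′) p q) (Gᵀ.col-unique m i′ i (swap i′ lt′) (swap i lt) q p)
    where
    module Gᵀ = Tracing (transpose G)
    swap : ∀ i → suc (i + m) < n → suc (m + i) < n
    swap i = subst (λ k → suc k < n) (+-comm i m)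

-- Partitions and their arcs

does⇒ : ∀ {P : Set} (d : Dec P) → does d ≡ true → P
does⇒ (yes p) _ = p

≡-by-true : ∀ {b b′ : Bool} → (b ≡ true → b′ ≡ true) → (b′ ≡ true → b ≡ true) → b ≡ b′
≡-by-true {true}          f g = sym (f refl)
≡-by-true {false} {true}  f g = g refl
≡-by-true {false} {false} f g = refl

module _ {n : ℕ} (R : Rel n) where

  same? : ∀ i j → Dec (Same R i j)
  same? i j = lookup (lookup R i) j Bool.≟ true

  arc? : ∀ i j → Dec (IsArc R i j)
  arc? i j = same? i j ×-dec (i Fin.<? j) ×-dec
    Fin.all? (λ l → same? i l →-dec ((i Fin.<? l) →-dec ¬? (l Fin.<? j)))

  next-arc : ∀ i j → Same R i j → i Fin.< j → ∃ λ l → IsArc R i l × l Fin.≤ j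
  next-arc i j = go (toℕ j) j ≤-refl
    where
    go : ∀ d j → toℕ j ≤ d → Same R i j → i Fin.< j → ∃ λ l → IsArc R i l × l Fin.≤ j
    go zero    j j≤d s i<j = ⊥-elim (n≮0 (≤-trans i<j j≤d))
    go (suc d) j j≤d s i<j with Fin.any? (λ l → same? i l ×-dec (i Fin.<? l) ×-dec (l Fin.<? j))
    ... | no none = j , (s , i<j , λ l s′ i<l l<j → none (l , s′ , i<l , l<j)) , ≤-refl
    ... | yes (l , s′ , i<l , l<j) with go d l (≤-pred (≤-trans l<j j≤d)) s′ i<l
    ...   | l′ , a , l′≤l = l′ , a , ≤-trans l′≤l (<⇒≤ l<j)

  arc-functional : ∀ {i j l} → IsArc R i j → IsArc R i l → j ≡ l
  arc-functional {i} {j} {l} (s , i<j , least) (s′ , i<l , least′) with Fin.<-cmp j l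
  ... | tri< j<l _ _ = ⊥-elim (least′ j s i<j j<l)
  ... | tri≈ _ eq _  = eq
  ... | tri> _ _ l<j = ⊥-elim (least l s′ i<l l<j)

module _ {n : ℕ} (R : Rel n) (isPart : IsPartition R) where

  private
    symR   = proj₁ (proj₂ isPart)
    transR = proj₂ (proj₂ isPart)

  arc-injective : ∀ {i j l} → IsArc R i l → IsArc R j l → i ≡ j
  arc-injective {i} {j} {l} (s , i<l , least) (s′ , j<l , least′) with Fin.<-cmp i j
  ... | tri< i<j _ _ = ⊥-elim (least j (transR i l j s (symR j l s′)) i<j j<l)
  ... | tri≈ _ eq _  = eq
  ... | tri> _ _ j<i = ⊥-elim (least′ i (transR j l i s′ (symR i l s)) j<i i<l)

  -- Inside a block the arcs link successive elements; the first arc from `i` ends at or before `j`,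
  -- so the distance to `j` drops.
  arc-induction : (Q : Fin n → Fin n → Set) → (∀ {i j} → IsArc R i j → Q i j) →
                  (∀ {i j l} → Q i j → Q j l → Q i l) → ∀ i j → Same R i j → i Fin.< j → Q i j
  arc-induction Q base glue i j = go (toℕ j) i (m≤m+n (toℕ j) (toℕ i))
    where
    go : ∀ d i → toℕ j ≤ d + toℕ i → Same R i j → i Fin.< j → Q i j
    go zero    i le s i<j = ⊥-elim (<⇒≱ i<j le)
    go (suc d) i le s i<j with next-arc R i j s i<j
    ... | l , a@(s′ , i<l , _) , l≤j with m≤n⇒m<n∨m≡n l≤j
    ...   | inj₂ eq  = subst (Q i) (Fin.toℕ-injective eq) (base a)
    ...   | inj₁ l<j = glue (base a) (go d l
              (≤-trans le (≤-trans (≤-reflexive (sym (+-suc d (toℕ i)))) (+-monoʳ-≤ d i<l)))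
              (transR l i j (symR i l s′) s) l<j)

  min⇒no-arc : ∀ {j} → IsMin R j → ∀ i → ¬ IsArc R i j
  min⇒no-arc {j} min i (s , i<j , _) = min i (symR i j s) i<j

  no-arc⇒min : ∀ {j} → (∀ i → ¬ IsArc R i j) → IsMin R j
  no-arc⇒min {j} none l s l<j with arc-induction (λ _ j → ∃ λ i → IsArc R i j) (λ a → _ , a) (λ _ q → q) l j (symR j l s) l<j
  ... | i , a = none i a

  max⇒no-arc : ∀ {i} → IsMax R i → ∀ j → ¬ IsArc R i j
  max⇒no-arc max j (s , i<j , _) = max j s i<j

  no-arc⇒max : ∀ {i} → (∀ j → ¬ IsArc R i j) → IsMax R i
  no-arc⇒max {i} none l s i<l with next-arc R i l s i<l
  ... | j , a , _ = none j a

same-mono : ∀ {n} (R R′ : Rel n) → IsPartition R → IsPartition R′ →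
            (∀ {i j} → IsArc R i j → IsArc R′ i j) → ∀ i j → Same R i j → Same R′ i j
same-mono R R′ pR@(_ , symR , _) (reflR′ , symR′ , transR′) arcs i j s with Fin.<-cmp i j
... | tri≈ _ refl _ = reflR′ i
... | tri< i<j _ _  = arc-induction R pR (Same R′) (λ a → proj₁ (arcs a)) (λ {i} {j} {l} → transR′ i j l) i j s i<j
... | tri> _ _ j<i  = symR′ j i (arc-induction R pR (Same R′) (λ a → proj₁ (arcs a)) (λ {i} {j} {l} → transR′ i j l) j i (symR i j s) j<i)

partition-ext : ∀ {n} (R R′ : Rel n) → IsPartition R → IsPartition R′ →
                (∀ {i j} → IsArc R i j → IsArc R′ i j) → (∀ {i j} → IsArc R′ i j → IsArc R i j) → R ≡ R′
partition-ext R R′ pR pR′ f g = Pointwise-≡⇒≡ (ext λ i → Pointwise-≡⇒≡ (ext λ j →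
  ≡-by-true (same-mono R R′ pR pR′ f i j) (same-mono R′ R pR′ pR g i j)))

-- The partition with prescribed arcs

module FromArcs {n : ℕ} (A : Fin n → Fin n → Bool) where

  pred? : ∀ i → Dec (∃ λ p → A p i ≡ true)
  pred? i = Fin.any? (λ p → A p i Bool.≟ true)

  climb : ℕ → Fin n → Fin n
  climb zero    i = i
  climb (suc d) i with pred? i
  ... | yes (p , _) = climb d p
  ... | no _        = i

  -- Each step along an increasing `A` lowers the index, so `n` steps reach the start of the path.
  -- Blocks are the fibres of `root` and form a partition whatever `A` is.
  root : Fin n → Fin n
  root = climb n

  fromArcs : Rel n
  fromArcs = tabulate λ i → tabulate λ j → does (root i Fin.≟ root j)

  private
    entry : ∀ i j → lookup (lookup fromArcs i) j ≡ does (root i Fin.≟ root j)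
    entry i j = trans (cong (λ v → lookup v j) (lookup∘tabulate _ i)) (lookup∘tabulate _ j)

  same⇒root : ∀ {i j} → Same fromArcs i j → root i ≡ root j
  same⇒root {i} {j} s = does⇒ (root i Fin.≟ root j) (trans (sym (entry i j)) s)

  root⇒same : ∀ {i j} → root i ≡ root j → Same fromArcs i j
  root⇒same {i} {j} eq = trans (entry i j) (dec-true (root i Fin.≟ root j) eq)

  isPartition : IsPartition fromArcs
  isPartition = (λ i → root⇒same refl) ,
                (λ i j s → root⇒same (sym (same⇒root s))) ,
                (λ i j l s s′ → root⇒same (trans (same⇒root s) (same⇒root s′)))

  module _ (increasing : ∀ {i j} → A i j ≡ true → i Fin.< j)
           (functional : ∀ {i j l} → A i j ≡ true → A i l ≡ true → j ≡ l)
           (injective  : ∀ {i j l} → A i l ≡ true → A j l ≡ true → i ≡ j) where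

    climb-≤ : ∀ d i → climb d i Fin.≤ i
    climb-≤ zero    i = ≤-refl
    climb-≤ (suc d) i with pred? i
    ... | yes (p , a) = ≤-trans (climb-≤ d p) (<⇒≤ (increasing a))
    ... | no _        = ≤-refl

    climb-stable : ∀ d i → toℕ i ≤ d → climb d i ≡ climb (suc d) i
    climb-stable zero i le with pred? i
    ... | yes (p , a) = ⊥-elim (n≮0 (≤-trans (increasing a) le))
    ... | no _        = refl
    climb-stable (suc d) i le with pred? i
    ... | yes (p , a) = climb-stable d p (≤-pred (≤-trans (increasing a) le))
    ... | no _        = refl

    root-cases : ∀ i → (∃ λ p → A p i ≡ true × root i ≡ root p) ⊎ root i ≡ i
    root-cases i with pred? i | climb-stable n i (<⇒≤ (Fin.toℕ<n i))
    ... | yes (p , a) | eq = inj₁ (p , a , eq)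
    ... | no _        | eq = inj₂ eq

    root-pred : ∀ {p i} → A p i ≡ true → root p ≡ root i
    root-pred {p} {i} a with pred? i | climb-stable n i (<⇒≤ (Fin.toℕ<n i))
    ... | yes (p′ , a′) | eq = trans (cong root (injective a a′)) (sym eq)
    ... | no none       | _  = ⊥-elim (none (p , a))

    root-next : ∀ i l → root i ≡ root l → i Fin.< l → ∃ λ j → A i j ≡ true × j Fin.≤ l
    root-next i l = go (toℕ l) i l ≤-refl
      where
      go : ∀ d i l → toℕ l ≤ d → root i ≡ root l → i Fin.< l → ∃ λ j → A i j ≡ true × j Fin.≤ l
      go zero    i l le eq i<l = ⊥-elim (n≮0 (≤-trans i<l le))
      go (suc d) i l le eq i<l with root-cases l
      ... | inj₂ top = ⊥-elim (<⇒≱ i<l (subst (Fin._≤ i) (trans eq top) (climb-≤ n i)))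
      ... | inj₁ (p , a , up) with Fin.<-cmp i p
      ...   | tri≈ _ refl _ = l , a , ≤-refl
      ...   | tri< i<p _ _ with go d i p (≤-pred (≤-trans (increasing a) le)) (trans eq up) i<p
      ...     | j , b , j≤p = j , b , ≤-trans j≤p (<⇒≤ (increasing a))
      -- The arc from `p` to `l` would jump over `i`, but by induction some arc from `p` ends at or
      -- before `i`, and `functional` identifies the two.
      go (suc d) i l le eq i<l | inj₁ (p , a , up) | tri> _ _ p<i
        with go d p i (≤-pred (≤-trans i<l le)) (sym (trans eq up)) p<i
      ...   | j , b , j≤i = ⊥-elim (<⇒≱ i<l (subst (Fin._≤ i) (functional b a) j≤i))

    arc⇒ : ∀ {i j} → IsArc fromArcs i j → A i j ≡ true
    arc⇒ {i} {j} (s , i<j , least) with root-next i j (same⇒root s) i<j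
    ... | l , a , l≤j with m≤n⇒m<n∨m≡n l≤j
    ...   | inj₂ eq  = subst (λ k → A i k ≡ true) (Fin.toℕ-injective eq) a
    ...   | inj₁ l<j = ⊥-elim (least l (root⇒same (root-pred a)) (increasing a) l<j)

    arc⇐ : ∀ {i j} → A i j ≡ true → IsArc fromArcs i j
    arc⇐ {i} {j} a = root⇒same (root-pred a) , increasing a , least
      where
      least : ∀ l → Same fromArcs i l → i Fin.< l → ¬ (l Fin.< j)
      least l s i<l l<j with root-next i l (same⇒root s) i<l
      ... | k , b , k≤l = <⇒≱ l<j (subst (Fin._≤ l) (functional b a) k≤l)

-- Arcs as points of the staircase

opp : ∀ {n} → Fin n → ℕ
opp q = toℕ (opposite q)

opp-sum : ∀ {n} (q : Fin n) → suc (toℕ q) + opp q ≡ n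
opp-sum q = trans (cong (suc (toℕ q) +_) (Fin.opposite-prop q)) (m+[n∸m]≡n (Fin.toℕ<n q))

opp-injective : ∀ {n} {q q′ : Fin n} → opp q ≡ opp q′ → q ≡ q′
opp-injective {q = q} {q′} eq = Fin.toℕ-injective (suc-injective (+-cancelʳ-≡ (opp q) _ _
  (trans (opp-sum q) (trans (sym (opp-sum q′)) (cong (suc (toℕ q′) +_) (sym eq))))))

opp-reverses : ∀ {n} {q q′ : Fin n} → q Fin.< q′ → opp q′ < opp q
opp-reverses {q = q} {q′} lt = +-cancelˡ-< (suc (toℕ q)) _ _ (begin-strict
    suc (toℕ q) + opp q′    <⟨ +-monoˡ-< (opp q′) (s≤s lt) ⟩
    suc (toℕ q′) + opp q′   ≡⟨ trans (opp-sum q′) (sym (opp-sum q)) ⟩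
    suc (toℕ q) + opp q     ∎)
  where open ≤-Reasoning

opp-reflects : ∀ {n} {q q′ : Fin n} → opp q′ < opp q → q Fin.< q′
opp-reflects {q = q} {q′} lt with Fin.<-cmp q q′
... | tri< q<q′ _ _ = q<q′
... | tri≈ _ refl _ = ⊥-elim (<-irrefl refl lt)
... | tri> _ _ q′<q = ⊥-elim (<-asym lt (opp-reverses q′<q))

below-diagonal : ∀ {n} {i : ℕ} {q : Fin n} → i < toℕ q → suc (i + opp q) < n
below-diagonal {n} {i} {q} lt = ≤-trans (s≤s (+-monoˡ-≤ (opp q) lt)) (≤-reflexive (opp-sum q))

below-diagonal⁻ : ∀ {n} {i : ℕ} {q : Fin n} → suc (i + opp q) < n → i < toℕ q
below-diagonal⁻ {n} {i} {q} lt = +-cancelʳ-≤ (opp q) (suc i) (toℕ q)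
  (≤-pred (≤-trans lt (≤-reflexive (sym (opp-sum q)))))

opp-onto : ∀ {n m} → m < n → ∃ λ (q : Fin n) → opp q ≡ m
opp-onto lt = opposite (fromℕ< lt) , trans (cong toℕ (Fin.opposite-involutive _)) (Fin.toℕ-fromℕ< lt)

module _ {n r : ℕ} where

  record ArcAt (Λ : Carrier n r) (c : Fin r) (i m : ℕ) : Set where
    constructor arcAt
    field
      {p q}  : Fin n
      p≡     : toℕ p ≡ i
      q≡     : opp q ≡ m
      arc    : IsArc (rel Λ) p q
      colour≡ : colour Λ p ≡ c

  arcAt? : ∀ (Λ : Carrier n r) c i m → Dec (∃ λ (p : Fin n) → ∃ λ (q : Fin n) → toℕ p ≡ i × opp q ≡ m × IsArc (rel Λ) p q × colour Λ p ≡ c)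
  arcAt? Λ c i m = Fin.any? λ p → Fin.any? λ q →
    (toℕ p ≟ i) ×-dec (opp q ≟ m) ×-dec arc? (rel Λ) p q ×-dec (colour Λ p Fin.≟ c)

  opaque
    arcBits : Carrier n r → Fin r → ℕ → ℕ → Bool
    arcBits Λ c i m = does (arcAt? Λ c i m)

    bit⇒arc : ∀ (Λ : Carrier n r) c i m → arcBits Λ c i m ≡ true → ArcAt Λ c i m
    bit⇒arc Λ c i m b with does⇒ (arcAt? Λ c i m) b
    ... | p , q , p≡ , q≡ , a , col = arcAt p≡ q≡ a col

    arc⇒bit : ∀ (Λ : Carrier n r) {p q} → IsArc (rel Λ) p q → arcBits Λ (colour Λ p) (toℕ p) (opp q) ≡ true
    arc⇒bit Λ a = dec-true (arcAt? Λ (colour Λ _) _ _) (_ , _ , refl , refl , a , refl)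

  bit⇒isArc : ∀ {Λ c} {p q : Fin n} → arcBits Λ c (toℕ p) (opp q) ≡ true → IsArc (rel Λ) p q
  bit⇒isArc {Λ} {c} {p} {q} b with bit⇒arc Λ c (toℕ p) (opp q) b
  ... | arcAt {p′} {q′} p≡ q≡ a _ = subst₂ (IsArc (rel Λ)) (Fin.toℕ-injective p≡) (opp-injective q≡) a

  arc-into : ∀ Λ {c} l → (∃ λ i → suc (i + opp l) < n × arcBits Λ c i (opp l) ≡ true) →
             ∃ λ p → IsArc (rel Λ) p l × colour Λ p ≡ c
  arc-into Λ {c} l (i , _ , b) with bit⇒arc Λ c i (opp l) b
  ... | arcAt {p} _ eq a col = p , subst (IsArc (rel Λ) p) (opp-injective eq) a , col

  arc-from : ∀ Λ {c i} → (∃ λ m → suc (i + m) < n × arcBits Λ c i m ≡ true) →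
             ∃ λ p → toℕ p ≡ i × colour Λ p ≡ c × ∃ (IsArc (rel Λ) p)
  arc-from Λ {c} {i} (m , _ , b) with bit⇒arc Λ c i m b
  ... | arcAt {p} {q} p≡ _ a col = p , p≡ , col , q , a

  arcBits-matching : ∀ Λ → IsPartition (rel Λ) → ∀ c → Matching (arcBits Λ c)
  arcBits-matching Λ pR c = record { col = col ; row = row }
    where
    col : ∀ i m m′ → arcBits Λ c i m ≡ true → arcBits Λ c i m′ ≡ true → m ≡ m′
    col i m m′ b b′ with bit⇒arc Λ c i m b | bit⇒arc Λ c i m′ b′
    ... | arcAt refl refl a _ | arcAt eq refl a′ _ with Fin.toℕ-injective eq
    ...   | refl = cong opp (arc-functional (rel Λ) a a′)
    row : ∀ i i′ m → arcBits Λ c i m ≡ true → arcBits Λ c i′ m ≡ true → i ≡ i′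
    row i i′ m b b′ with bit⇒arc Λ c i m b | bit⇒arc Λ c i′ m b′
    ... | arcAt refl refl a _ | arcAt refl eq a′ _ with opp-injective eq
    ...   | refl = cong toℕ (arc-injective (rel Λ) pR a a′)

  -- Symmetric by `⋈-sym` and functional by `⋈-unique`; all properties of `mutate` are proved for
  -- this relation.
  record _⋈_ (Λ Λ′ : Carrier n r) : Set where
    field
      partˡ   : IsPartition (rel Λ)
      partʳ   : IsPartition (rel Λ′)
      colours : proj₂ Λ ≡ proj₂ Λ′
      dual    : ∀ c → Dual n (arcBits Λ c) (arcBits Λ′ c)

  ⋈-sym : ∀ {Λ Λ′} → Λ ⋈ Λ′ → Λ′ ⋈ Λ
  ⋈-sym D = record { partˡ = partʳ ; partʳ = partˡ ; colours = sym colours ; dual = λ c → dual-sym (dual c) }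
    where open _⋈_ D

  ⋈-unique : ∀ {Λ Λ₁ Λ₂} → Λ ⋈ Λ₁ → Λ ⋈ Λ₂ → Λ₁ ≡ Λ₂
  ⋈-unique {Λ} {Λ₁} {Λ₂} D₁ D₂ = cong₂ _,_ (partition-ext (rel Λ₁) (rel Λ₂) D₁.partʳ D₂.partʳ (arcs D₁ D₂) (arcs D₂ D₁))
                              (trans (sym D₁.colours) D₂.colours)
    where
    module D₁ = _⋈_ D₁
    module D₂ = _⋈_ D₂
    arcs : ∀ {Λ₁ Λ₂} → Λ ⋈ Λ₁ → Λ ⋈ Λ₂ → ∀ {i j} → IsArc (rel Λ₁) i j → IsArc (rel Λ₂) i j
    arcs {Λ₁} {Λ₂} D₁ D₂ {i} {j} a = bit⇒isArc {Λ₂} {c} (trans (sym (dual-functional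
        (_⋈_.dual D₁ c) (_⋈_.dual D₂ c) (λ _ _ _ → refl) (toℕ i) (opp j) (below-diagonal (proj₁ (proj₂ a))))) (arc⇒bit Λ₁ a))
      where c = colour Λ₁ i

  -- The colour vector is kept because the openers of each colour are.
  mutate : Carrier n r → Carrier n r
  mutate Λ = FromArcs.fromArcs (λ p q → dualBits n (arcBits Λ (colour Λ p)) (toℕ p) (opp q)) , proj₂ Λ

  mutate-⋈ : ∀ Λ → IsPartition (rel Λ) → Λ ⋈ mutate Λ
  mutate-⋈ Λ pR = record
    { partˡ = pR
    ; partʳ = FromArcs.isPartition A
    ; colours = refl
    ; dual = λ c → dual-transport (D c) (λ i m lt → ≡-by-true (dual⇒bit c) (bit⇒dual c))
    }
    where
    B̃ : Fin r → ℕ → ℕ → Bool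
    B̃ c = dualBits n (arcBits Λ c)
    A : Fin n → Fin n → Bool
    A p q = B̃ (colour Λ p) (toℕ p) (opp q)
    D : ∀ c → Dual n (arcBits Λ c) (B̃ c)
    D c = dualBits-dual (arcBits-matching Λ pR c)
    support : ∀ c {i m} → B̃ c i m ≡ true → suc (i + m) < n
    support c = dualBits-support n (arcBits Λ c) _ _
    increasing : ∀ {i j} → A i j ≡ true → i Fin.< j
    increasing {i} a = below-diagonal⁻ (support (colour Λ i) a)
    functional : ∀ {i j l} → A i j ≡ true → A i l ≡ true → j ≡ l
    functional {i} a b = opp-injective (dual-col-unique (dual-sym (D c)) _ _ _ (support c a) (support c b) a b)
      where c = colour Λ i
    -- The only interaction between colours: closers are kept colour by colour, so both new arcs
    -- into `l` have the colour of the one old arc into `l`.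
    same-colour : ∀ {i j l} → A i l ≡ true → A j l ≡ true → colour Λ j ≡ colour Λ i
    same-colour {i} {j} {l} a b = trans (sym (proj₂ (proj₂ q))) (trans (cong (colour Λ)
        (arc-injective (rel Λ) pR (proj₁ (proj₂ q)) (proj₁ (proj₂ p)))) (proj₂ (proj₂ p)))
      where
      p = arc-into Λ l (dual-closer (D (colour Λ i)) (support (colour Λ i) a) a)
      q = arc-into Λ l (dual-closer (D (colour Λ j)) (support (colour Λ j) b) b)
    injective : ∀ {i j l} → A i l ≡ true → A j l ≡ true → i ≡ j
    injective {i} {j} {l} a b = Fin.toℕ-injective
        (dual-row-unique (dual-sym (D c)) _ _ _ (support c a) (support c b′) a b′)
      where
      c = colour Λ i
      b′ : B̃ c (toℕ j) (opp l) ≡ true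
      b′ = subst (λ c → B̃ c (toℕ j) (opp l) ≡ true) (same-colour {i} {j} {l} a b) b
    -- `A` reads only the dual of the colour stored at its left end. A dual point of colour `c` in
    -- column `i` is still seen, as the kept opener shows that `c` is the colour stored there.
    dual⇒bit : ∀ c {i m} → B̃ c i m ≡ true → arcBits (mutate Λ) c i m ≡ true
    dual⇒bit c {i} {m} b = at (arc-from Λ (dual-opener (D c) (support c b) b))
                              (opp-onto (≤-trans (s≤s (m≤n+m m (suc i))) (support c b)))
      where
      at : (∃ λ p → toℕ p ≡ i × colour Λ p ≡ c × ∃ (IsArc (rel Λ) p)) → (∃ λ q → opp q ≡ m) → arcBits (mutate Λ) c i m ≡ true
      at (p , refl , refl , _) (q , refl) = arc⇒bit (mutate Λ) (FromArcs.arc⇐ A increasing functional injective b)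
    bit⇒dual : ∀ c {i m} → arcBits (mutate Λ) c i m ≡ true → B̃ c i m ≡ true
    bit⇒dual c {i} {m} b with bit⇒arc (mutate Λ) c i m b
    ... | arcAt refl refl a refl = FromArcs.arc⇒ A increasing functional injective a

-- Transfer to coloured partitions

Descending Ascending : ∀ {k} → (Fin k → ℕ) → Set
Descending a = ∀ {s t} → s Fin.< t → a t < a s
Ascending  a = ∀ {s t} → s Fin.< t → a s < a t

-- Index 0 is the point added last, the rightmost one; arc sequences are therefore reversed by
-- `opposite` before they are turned into chains.
build-inc : ∀ {B k} (a m : Fin k → ℕ) → (∀ t → B (a t) (m t) ≡ true) → Descending a → Descending m →
            ∀ {x z} → (∀ t → a t < x) → (∀ t → m t < z) → IncChain B k x z
build-inc {k = zero}  a m b da dm ax mz = nil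
build-inc {k = suc k} a m b da dm ax mz =
  snoc (build-inc (a ∘ Fin.suc) (m ∘ Fin.suc) (b ∘ Fin.suc) (da ∘ s≤s) (dm ∘ s≤s)
         (λ t → da {Fin.zero} {Fin.suc t} (s≤s z≤n)) (λ t → dm {Fin.zero} {Fin.suc t} (s≤s z≤n)))
       (b Fin.zero) (ax Fin.zero) (mz Fin.zero)

build-dec : ∀ {Q z k} (a m : Fin k → ℕ) → (∀ t → Q (a t) (m t)) → Descending a → Ascending m →
            ∀ {x y} → (∀ t → a t < x) → (∀ t → y ≤ m t) → (∀ t → m t < z) → DecChain Q z k x y
build-dec {k = zero}  a m b da dm ax my mz = nil
build-dec {k = suc k} a m b da dm ax my mz =
  snoc (build-dec (a ∘ Fin.suc) (m ∘ Fin.suc) (b ∘ Fin.suc) (da ∘ s≤s) (dm ∘ s≤s)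
         (λ t → da {Fin.zero} {Fin.suc t} (s≤s z≤n)) (λ t → dm {Fin.zero} {Fin.suc t} (s≤s z≤n)) (mz ∘ Fin.suc))
       (b Fin.zero) (ax Fin.zero) (my Fin.zero) (mz Fin.zero)

record Points (Q : ℕ → ℕ → Set) (k x z : ℕ) : Set where
  field
    a m    : Fin k → ℕ
    holds  : ∀ t → Q (a t) (m t)
    a-desc : Descending a
    a<x    : ∀ t → a t < x
    m<z    : ∀ t → m t < z

∷-all : ∀ {k x} (P : ℕ → Set) {f : Fin k → ℕ} → P x → (∀ t → P (f t)) → ∀ t → P ((x ∷ f) t)
∷-all P p h Fin.zero    = p
∷-all P p h (Fin.suc t) = h t

∷-desc : ∀ {k x} {f : Fin k → ℕ} → (∀ t → f t < x) → Descending f → Descending (x ∷ f)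
∷-desc h d {Fin.zero}  {Fin.suc t} _        = h t
∷-desc h d {Fin.suc s} {Fin.suc t} (s≤s lt) = d lt

∷-asc : ∀ {k x} {f : Fin k → ℕ} → (∀ t → x < f t) → Ascending f → Ascending (x ∷ f)
∷-asc h d {Fin.zero}  {Fin.suc t} _        = h t
∷-asc h d {Fin.suc s} {Fin.suc t} (s≤s lt) = d lt

inc-points : ∀ {B k x z} → IncChain B k x z → Σ (Points (λ i m → B i m ≡ true) k x z) (Descending ∘ Points.m)
inc-points nil = record { a = λ () ; m = λ () ; holds = λ () ; a-desc = λ { {()} } ; a<x = λ () ; m<z = λ () } , λ { {()} }
inc-points (snoc {i = i} {m} c b i<x m<z) with inc-points c
... | pts , m-desc = record
  { a = i ∷ a ; m = m ∷ ms
  ; holds = λ { Fin.zero → b ; (Fin.suc t) → holds t }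
  ; a-desc = ∷-desc a<x a-desc
  ; a<x = ∷-all (_< _) i<x λ t → <-trans (a<x t) i<x
  ; m<z = ∷-all (_< _) m<z λ t → <-trans (ms<z t) m<z
  } , ∷-desc ms<z m-desc
  where open Points pts renaming (m to ms; m<z to ms<z)

dec-points : ∀ {Q z k x y} → DecChain Q z k x y →
             Σ (Points Q k x z) λ p → Ascending (Points.m p) × (∀ t → y ≤ Points.m p t)
dec-points nil = record { a = λ () ; m = λ () ; holds = λ () ; a-desc = λ { {()} } ; a<x = λ () ; m<z = λ () } , (λ { {()} }) , λ ()
dec-points (snoc {i = i} {m} c b i<x y≤m m<z) with dec-points c
... | pts , m-asc , m<ms = record
  { a = i ∷ a ; m = m ∷ ms
  ; holds = λ { Fin.zero → b ; (Fin.suc t) → holds t }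
  ; a-desc = ∷-desc a<x a-desc
  ; a<x = ∷-all (_< _) i<x λ t → <-trans (a<x t) i<x
  ; m<z = ∷-all (_< _) m<z ms<z
  } , ∷-asc m<ms m-asc , ∷-all (_ ≤_) y≤m λ t → ≤-trans y≤m (<⇒≤ (m<ms t))
  where open Points pts renaming (m to ms; m<z to ms<z)

-- Translates the height bound `z` of the rectangle into an arc ending at or after the cut `x`.
opp-< : ∀ {n x z} {q : Fin n} → x + z ≡ n → x ≤ toℕ q → opp q < z
opp-< {n} {x} {z} {q} eq le = +-cancelˡ-< x _ _ (≤-trans (s≤s (+-monoˡ-≤ (opp q) le)) (≤-reflexive (trans (opp-sum q) (sym eq))))

opp-<⁻ : ∀ {n x z} {q : Fin n} → x + z ≡ n → opp q < z → x ≤ toℕ q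
opp-<⁻ {n} {x} {z} {q} eq lt = ≮⇒≥ λ q<x → <-irrefl (trans (opp-sum q) (sym eq)) (+-mono-≤-< q<x lt)

module _ {n r : ℕ} (Λ : Carrier n r) where

  private
    desc-≤ : ∀ {k} {a : Fin (suc k) → ℕ} → Descending a → ∀ t → a t ≤ a Fin.zero
    desc-≤ d Fin.zero    = ≤-refl
    desc-≤ d (Fin.suc t) = <⇒≤ (d {Fin.zero} {Fin.suc t} (s≤s z≤n))

  module ArcSequence {k : ℕ} (a b : Fin (suc k) → Fin n)
    (arcs : ∀ t → IsArc (rel Λ) (a t) (b t)) (mono : ∀ s t → colour Λ (a s) ≡ colour Λ (a t))
    (a-asc : ∀ s t → s Fin.< t → a s Fin.< a t) (a<b : ∀ s t → a s Fin.< b t) where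

    last : Fin (suc k)
    last = opposite Fin.zero

    c : Fin r
    c = colour Λ (a last)

    x z : ℕ
    -- Cut just after the last left end; by `a<b` every right end is at or beyond it.
    x = suc (toℕ (a last))
    z = n ∸ x

    x+z : x + z ≡ n
    x+z = m+[n∸m]≡n (Fin.toℕ<n (a last))

    i m : Fin (suc k) → ℕ
    i t = toℕ (a (opposite t))
    m t = opp (b (opposite t))

    bit : ∀ t → arcBits Λ c (i t) (m t) ≡ true
    bit t = subst (λ c → arcBits Λ c (i t) (m t) ≡ true) (mono (opposite t) last) (arc⇒bit Λ (arcs (opposite t)))

    i-desc : Descending i
    i-desc lt = a-asc _ _ (opp-reverses lt)

    i<x : ∀ t → i t < x
    i<x t = s≤s (desc-≤ {a = i} i-desc t)

    m<z : ∀ t → m t < z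
    m<z t = opp-< x+z (a<b last (opposite t))

  nesting⇒chain : ∀ {k} → HasNesting Λ (suc k) →
    ∃ λ c → ∃ λ x → ∃ λ z → x + z ≡ n × IncChain (arcBits Λ c) (suc k) x z
  nesting⇒chain (a , b , arcs , mono , a-asc , a<b , b-desc) =
    c , x , z , x+z , build-inc i m bit i-desc (λ lt → opp-reverses (b-desc _ _ (opp-reverses lt))) i<x m<z
    where open ArcSequence a b arcs mono a-asc a<b

  crossing⇒chain : ∀ {k} → HasCrossing Λ (suc k) →
    ∃ λ c → ∃ λ x → ∃ λ z → x + z ≡ n × DecChain (λ i m → arcBits Λ c i m ≡ true) z (suc k) x 0
  crossing⇒chain (a , b , arcs , mono , a-asc , a<b , b-asc) =
    c , x , z , x+z , build-dec i m bit i-desc (λ lt → opp-reverses (b-asc _ _ (opp-reverses lt))) i<x (λ _ → z≤n) m<z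
    where open ArcSequence a b arcs mono a-asc a<b

  module PointSequence {c k x z} (x+z : x + z ≡ n) (pts : Points (λ i m → arcBits Λ c i m ≡ true) k x z) where
    open Points pts

    at : ∀ t → ArcAt Λ c (a t) (m t)
    at t = bit⇒arc Λ c (a t) (m t) (holds t)

    p q : Fin k → Fin n
    p t = ArcAt.p (at (opposite t))
    q t = ArcAt.q (at (opposite t))

    p≡ : ∀ t → toℕ (p t) ≡ a (opposite t)
    p≡ t = ArcAt.p≡ (at (opposite t))

    q≡ : ∀ t → opp (q t) ≡ m (opposite t)
    q≡ t = ArcAt.q≡ (at (opposite t))

    arcs : ∀ t → IsArc (rel Λ) (p t) (q t)
    arcs t = ArcAt.arc (at (opposite t))

    mono : ∀ s t → colour Λ (p s) ≡ colour Λ (p t)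
    mono s t = trans (ArcAt.colour≡ (at (opposite s))) (sym (ArcAt.colour≡ (at (opposite t))))

    p-asc : ∀ s t → s Fin.< t → p s Fin.< p t
    p-asc s t lt = subst₂ _<_ (sym (p≡ s)) (sym (p≡ t)) (a-desc (opp-reverses lt))

    -- The cut `x` separates all left ends from all right ends.
    p<q : ∀ s t → p s Fin.< q t
    p<q s t = ≤-trans (subst (_< x) (sym (p≡ s)) (a<x (opposite s)))
                      (opp-<⁻ x+z (subst (_< z) (sym (q≡ t)) (m<z (opposite t))))

  chain⇒nesting : ∀ {c k x z} → x + z ≡ n → IncChain (arcBits Λ c) k x z → HasNesting Λ k
  chain⇒nesting x+z chain with inc-points chain
  ... | pts , m-desc = p , q , arcs , mono , p-asc , p<q ,
        λ s t lt → opp-reflects (subst₂ _<_ (sym (q≡ s)) (sym (q≡ t)) (m-desc (opp-reverses lt)))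
    where open PointSequence x+z pts

  chain⇒crossing : ∀ {c k x z} → x + z ≡ n → DecChain (λ i m → arcBits Λ c i m ≡ true) z k x 0 → HasCrossing Λ k
  chain⇒crossing x+z chain with dec-points chain
  ... | pts , m-asc , _ = p , q , arcs , mono , p-asc , p<q ,
        λ s t lt → opp-reflects (subst₂ _<_ (sym (q≡ t)) (sym (q≡ s)) (m-asc (opp-reverses lt)))
    where open PointSequence x+z pts

module _ {n r : ℕ} {Λ Λ′ : Carrier n r} (D : Λ ⋈ Λ′) where
  open _⋈_ D

  ⋈-nesting : ∀ k → HasNesting Λ k → HasCrossing Λ′ k
  -- The empty sequence provides neither a colour nor a cut, and is a crossing and a nesting at
  -- once.
  ⋈-nesting zero    _ = (λ ()) , (λ ()) , (λ ()) , (λ ()) , (λ ()) , (λ ()) , λ ()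
  ⋈-nesting (suc k) h with nesting⇒chain Λ h
  ... | c , x , z , eq , chain = chain⇒crossing Λ′ {c} eq (IncChain⇒DecChain (dual c) eq chain)

  ⋈-crossing : ∀ k → HasCrossing Λ k → HasNesting Λ′ k
  ⋈-crossing zero    _ = (λ ()) , (λ ()) , (λ ()) , (λ ()) , (λ ()) , (λ ()) , λ ()
  ⋈-crossing (suc k) h with crossing⇒chain Λ h
  ... | c , x , z , eq , chain = chain⇒nesting Λ′ {c} eq (DecChain⇒IncChain (dual c) eq chain)

  ⋈-min : ∀ j → IsMin (rel Λ) j → IsMin (rel Λ′) j
  ⋈-min j min = no-arc⇒min (rel Λ′) partʳ no-arc
    where
    no-arc : ∀ i → ¬ IsArc (rel Λ′) i j
    no-arc i a = min⇒no-arc (rel Λ) partˡ min (proj₁ into) (proj₁ (proj₂ into))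
      where into = arc-into Λ j (dual-closer (dual (colour Λ′ i)) (below-diagonal (proj₁ (proj₂ a))) (arc⇒bit Λ′ a))

  ⋈-max : ∀ i → IsMax (rel Λ) i → IsMax (rel Λ′) i
  ⋈-max i max = no-arc⇒max (rel Λ′) partʳ no-arc
    where
    no-arc : ∀ j → ¬ IsArc (rel Λ′) i j
    no-arc j a = refute (arc-from Λ (dual-opener (dual (colour Λ′ i)) (below-diagonal (proj₁ (proj₂ a))) (arc⇒bit Λ′ a)))
      where
      refute : ¬ (∃ λ p → toℕ p ≡ toℕ i × colour Λ p ≡ colour Λ′ i × ∃ (IsArc (rel Λ) p))
      refute (p , eq , _ , q , a′) =
        max⇒no-arc (rel Λ) partˡ max q (subst (λ p → IsArc (rel Λ) p q) (Fin.toℕ-injective eq) a′)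

-- Both bounds are pulled back along `D⁻`: a crossing of `Λ′` is a nesting of `Λ` and conversely.
-- The colour normalisation survives because colours and maxima do.
⋈-NCN : ∀ {n r} {Λ Λ′ : Carrier n r} → Λ ⋈ Λ′ → ∀ {j k S T} → NCNSet n r j k S T Λ → NCNSet n r k j S T Λ′
⋈-NCN {Λ = Λ} {Λ′} D ((_ , normal) , cr , ne , mins , maxs) =
  (partʳ , λ i max → subst (λ v → toℕ (lookup v i) ≡ 0) colours (normal i (⋈-max D⁻ i max))) ,
  (λ m le h → ne m le (⋈-crossing D⁻ m h)) ,
  (λ m le h → cr m le (⋈-nesting D⁻ m h)) ,
  (λ i → mk⇔ (⋈-min D i ∘ Equivalence.to (mins i)) (Equivalence.from (mins i) ∘ ⋈-min D⁻ i)) ,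
  (λ i → mk⇔ (⋈-max D i ∘ Equivalence.to (maxs i)) (Equivalence.from (maxs i) ∘ ⋈-max D⁻ i))
  where
  open _⋈_ D
  D⁻ = ⋈-sym D

-- `mutate (mutate Λ)` and `Λ` are both partners of `mutate Λ`.
mutate-involutive : ∀ {n r} (Λ : Carrier n r) → IsPartition (rel Λ) → mutate (mutate Λ) ≡ Λ
mutate-involutive Λ pR = ⋈-unique (mutate-⋈ (mutate Λ) (_⋈_.partʳ D)) (⋈-sym D)
  where D = mutate-⋈ Λ pR

theorem1p4 : (n r : ℕ) → 1 ≤ n → 1 ≤ r → (j k : ℤ) → (S T : Subset n) →
    SameCount (NCNSet n r j k S T) (NCNSet n r k j S T)
theorem1p4 n r _ _ j k S T = mutate , mutate ,
  (λ Λ h → ⋈-NCN (mutate-⋈ Λ (part Λ h)) h) , (λ Λ h → ⋈-NCN (mutate-⋈ Λ (part Λ h)) h) ,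
  (λ Λ h → mutate-involutive Λ (part Λ h)) , (λ Λ h → mutate-involutive Λ (part Λ h))
  where
  part : ∀ {j k} Λ → NCNSet n r j k S T Λ → IsPartition (rel Λ)
  part Λ h = proj₁ (proj₁ h)
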